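{- Let $\mathfrak{A}$ be an atomic weakly associative relation algebra and let $\mathfrak{B}=\langle B,T_\kappa,E_{\kappa\lambda}\rangle_{\kappa,\lambda<3}$ be its suitable structure. Then $\mathfrak{Cm}\,\mathfrak{B}\cong\mathfrak{Rc}\,\mathfrak{B}$, via the map $R$ defined for $X\subseteq B$ by $R(X)=\bigcup_{t\in X}R_t$.
   Context: WA: algebras $\langle A,+,\overline{\phantom{x}},;,\breve{\phantom{x}},1'\rangle$ with $x\cdot y=\overline{\overline{x}+\overline{y}}$, $0'=\overline{1'}$, $1=1'+0'$, $0=\overline{1}$, satisfying for all $x,y,z$: $x+y=y+x$; $x+(y+z)=(x+y)+z$; $\overline{\overline{x}+\overline{y}}+\overline{\overline{x}+y}=x$; $((x\cdot 1');1);1=(x\cdot1');1$; $(x+y);z=x;z+y;z$; $x;1'=x$; $\breve{\breve{x}}=x$; $\breve{(x+y)}=\breve{x}+\breve{y}$; $\breve{(x;y)}=\breve{y};\breve{x}$; $\breve{x};\overline{x;y}+\overline{y}=\overline{y}$. $\mathrm{At}(\mathfrak{A})$ = set of atoms. Suitable structure: $B=\{s\in{}^3\mathrm{At}(\mathfrak{A}): s_2;s_0\ge s_1\}$; $T_\kappa=\{\langle s,t\rangle\in B\times B:s_\kappa=t_\kappa\}$; $E_{\kappa\kappa}=B$; for distinct $\kappa,\lambda$ with third index $\mu$, $E_{\kappa\lambda}=\{s\in B:s_\mu\le1'\}$. Complex algebra: $\mathfrak{Cm}\,\mathfrak{B}=\langle\mathcal{P}(B),\cup,\cap,B\setminus\cdot,\emptyset,B,T_\kappa^*,E_{\kappa\lambda}\rangle_{\kappa,\lambda<3}$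 with $T_\kappa^*(X)=\{y\in B:\exists x\in X\ \langle y,x\rangle\in T_\kappa\}$. Trails: a $\mathfrak{B}$-trail is $p=\langle t_0,\kappa_0,\dots,t_n,\kappa_n\rangle$, $n\in\omega$, $t_i\in B$, $\kappa_i<3$, with $t_i\ne t_{i+1}$ and $\langle t_i,t_{i+1}\rangle\in T_{\kappa_i}$ for $i<n$; it ends at $t_n$. $\mathrm{Tr}(\mathfrak{B})$ = set of trails; $p\lambda=\langle t_0,\kappa_0,\dots,t_n,\lambda\rangle$. $\approx$ is the smallest equivalence relation on $\mathrm{Tr}(\mathfrak{B})$ with (for trails of the displayed forms): (a) $\langle t_0,\kappa_0,\dots,t_i,\lambda,s,\lambda,t_i,\kappa_i,\dots,t_n,\kappa_n\rangle\approx\langle t_0,\kappa_0,\dots,t_i,\kappa_i,\dots,t_n,\kappa_n\rangle$; (b) $\langle t_0,\kappa_0,\dots,t_n,\lambda,s,\nu\rangle\approx\langle t_0,\kappa_0,\dots,t_n,\nu\rangle$ if $\lambda\ne\nu$; (c) $\langle t_0,\kappa_0,\dots,t_n,\lambda\rangle\approx\langle t_0,\kappa_0,\dots,t_n,\kappa_n\rangle$ if $t_n\in E_{\lambda\kappa_n}$. $p^{\mathfrak{B}}$ = $\approx$-class of $p$; $U(\mathfrak{B})=\{p^{\mathfrak{B}}:p\in\mathrm{Tr}(\mathfrak{B})\}$; $R_t=\{\langle(p0)^{\mathfrak{B}},(p1)^{\mathfrak{B}},(p2)^{\mathfrak{B}}\rangle:p\in\mathrm{Tr}(\mathfrak{B})\text{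 ends at }t\}$; $V(\mathfrak{B})=\bigcup_{t\in B}R_t$. Set algebras: the full 3-dimensional cylindric set algebra on $U$ is $\langle\mathcal{P}({}^3U),\cup,{}^3U\setminus\cdot,C_\kappa,D_{\kappa\lambda}\rangle_{\kappa,\lambda<3}$ with $C_\kappa X=\{v\in{}^3U:\exists u\in X\ \forall\lambda\ne\kappa\ u_\lambda=v_\lambda\}$ and $D_{\kappa\lambda}=\{v\in{}^3U:v_\kappa=v_\lambda\}$. Let $\mathfrak{C}$ be the subalgebra of the full cylindric set algebra on $U(\mathfrak{B})$ completely generated by $\{R_t:t\in B\}$ (closed under arbitrary unions). $\mathfrak{Rc}\,\mathfrak{B}$ is the relativization of $\mathfrak{C}$ to $V=V(\mathfrak{B})$: universe $\{X\in C:X\subseteq V\}$, operations $\cup$, $V\setminus\cdot$, $C^{[V]}_\kappa X=V\cap C_\kappa X$, constants $D^{[V]}_{\kappa\lambda}=V\cap D_{\kappa\lambda}$. -}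

module Defs where

open import Level using (Level; suc; _⊔_; Lift; lift)
open import Axiom.ExcludedMiddle using (ExcludedMiddle)
open import Data.Empty.Polymorphic using (⊥)
open import Data.Fin.Base using (Fin)
open import Data.Fin.Patterns using (0F; 1F; 2F)
open import Data.List.Base using (List; []; _∷_; _++_; _∷ʳ_)
open import Data.List.Relation.Binary.Pointwise using (Pointwise)
open import Data.List.Relation.Unary.Linked using (Linked; [-]; _∷_)
open import Data.Product.Base using (Σ-syntax; ∃-syntax; _×_; _,_; proj₁; proj₂)
open import Data.Sum.Base using (_⊎_; inj₁; inj₂)
open import Data.Unit.Polymorphic using (⊤; tt)
open import Data.Vec.Functional.Relation.Binary.Equality.Setoid using (≋-setoid)
open import Function.Base using (_∘_)
open import Function.Definitions using (Injective; Surjective)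
open import Relation.Binary.Bundles using (Setoid)
open import Relation.Binary.Core using (Rel)
open import Relation.Binary.Definitions using (_Respects_; _Respects₂_)
open import Relation.Binary.PropositionalEquality.Core using (_≡_; _≢_)
open import Relation.Binary.Structures using (IsEquivalence)
import Relation.Binary.Construct.Closure.Equivalence as EqClosure
open import Relation.Nullary using (¬_)
open import Relation.Nullary.Decidable using (decidable-stable)
open import Relation.Unary using (Pred; _⊆_; _≐_; ⋃)

record WA (a ℓ : Level) : Set (suc (a ⊔ ℓ)) where
  infix  4 _≈_
  infixl 6 _+_
  infixl 7 _·_ _⨾_
  infix  8 -_
  infix  9 _˘
  field
    Carrier       : Set a
    _≈_           : Rel Carrier ℓ
    isEquivalence : IsEquivalence _≈_
    _+_           : Carrier → Carrier → Carrier
    -_            : Carrier → Carrier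
    _⨾_           : Carrier → Carrier → Carrier
    _˘            : Carrier → Carrier
    1′            : Carrier

  _·_ : Carrier → Carrier → Carrier
  x · y = - (- x + - y)

  0′ : Carrier
  0′ = - 1′

  1# : Carrier
  1# = 1′ + 0′

  0# : Carrier
  0# = - 1#

  field
    +-cong : ∀ {x x′ y y′} → x ≈ x′ → y ≈ y′ → x + y ≈ x′ + y′
    -‿cong : ∀ {x x′} → x ≈ x′ → - x ≈ - x′
    ⨾-cong : ∀ {x x′ y y′} → x ≈ x′ → y ≈ y′ → x ⨾ y ≈ x′ ⨾ y′
    ˘-cong : ∀ {x x′} → x ≈ x′ → x ˘ ≈ x′ ˘

    +-comm       : ∀ x y → x + y ≈ y + x
    +-assoc      : ∀ x y z → x + (y + z) ≈ (x + y) + z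
    huntington   : ∀ x y → - (- x + - y) + - (- x + y) ≈ x
    ⨾-weak-assoc : ∀ x → ((x · 1′) ⨾ 1#) ⨾ 1# ≈ (x · 1′) ⨾ 1#
    ⨾-distribʳ-+ : ∀ x y z → (x + y) ⨾ z ≈ x ⨾ z + y ⨾ z
    ⨾-identityʳ  : ∀ x → x ⨾ 1′ ≈ x
    ˘-involutive : ∀ x → x ˘ ˘ ≈ x
    ˘-+          : ∀ x y → (x + y) ˘ ≈ x ˘ + y ˘
    ˘-⨾          : ∀ x y → (x ⨾ y) ˘ ≈ y ˘ ⨾ x ˘
    tarski       : ∀ x y → x ˘ ⨾ - (x ⨾ y) + - y ≈ - y

  open IsEquivalence isEquivalence public
    renaming (refl to ≈-refl; sym to ≈-sym; trans to ≈-trans)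

  infix 4 _≤_
  _≤_ : Rel Carrier ℓ
  x ≤ y = x + y ≈ y

  IsAtom : Pred Carrier (a ⊔ ℓ)
  IsAtom x = ¬ x ≈ 0# × (∀ y → y ≤ x → ¬ y ≈ 0# → y ≈ x)

  record At : Set (a ⊔ ℓ) where
    field
      elem   : Carrier
      isAtom : IsAtom elem

  Atomic : Set (a ⊔ ℓ)
  Atomic = ∀ x → ¬ x ≈ 0# → Σ[ α ∈ At ] At.elem α ≤ x

record AtomStructure (b ℓ : Level) : Set (suc (b ⊔ ℓ)) where
  field
    setoid : Setoid b ℓ
  open Setoid setoid public renaming (Carrier to B)
  field
    T      : Fin 3 → Rel B ℓ
    E      : Fin 3 → Fin 3 → Pred B ℓ
    T-resp : ∀ κ → T κ Respects₂ _≈_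
    E-resp : ∀ κ ν → E κ ν Respects _≈_

module _ {a ℓ : Level} (𝔄 : WA a ℓ) where
  open WA 𝔄

  record Triple : Set (a ⊔ ℓ) where
    field
      atom  : Fin 3 → At
      cycle : At.elem (atom 1F) ≤ At.elem (atom 2F) ⨾ At.elem (atom 0F)

  infix 10 _!_
  _!_ : Triple → Fin 3 → Carrier
  s ! κ = At.elem (Triple.atom s κ)

  data Diagonal (s : Triple) (κ : Fin 3) : Fin 3 → Set ℓ where
    same     : Diagonal s κ κ
    distinct : ∀ {ν} μ → κ ≢ ν → μ ≢ κ → μ ≢ ν → s ! μ ≤ 1′ → Diagonal s κ ν

  -- Triples are compared by their atoms only, ignoring the proofs they carry.
  suitableStructure : AtomStructure (a ⊔ ℓ) ℓ
  suitableStructure = record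
    { setoid = record
      { Carrier       = Triple
      ; _≈_           = λ s t → ∀ κ → s ! κ ≈ t ! κ
      ; isEquivalence = record
        { refl  = λ κ → ≈-refl
        ; sym   = λ s≈t κ → ≈-sym (s≈t κ)
        ; trans = λ s≈t t≈u κ → ≈-trans (s≈t κ) (t≈u κ)
        }
      }
    ; T      = λ κ s t → s ! κ ≈ t ! κ
    ; E      = λ κ ν s → Diagonal s κ ν
    ; T-resp = λ κ → (λ t≈u st → ≈-trans st (t≈u κ))
                   , (λ s≈u st → ≈-trans (≈-sym (s≈u κ)) st)
    ; E-resp = λ { κ .κ s≈t same → same
                 ; κ ν s≈t (distinct μ κ≢ν μ≢κ μ≢ν sμ≤1′) →
                     distinct μ κ≢ν μ≢κ μ≢ν
                       (≈-trans (+-cong (≈-sym (s≈t μ)) ≈-refl) sμ≤1′) }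
    }

record RawCylindricAlgebra (c ℓ : Level) : Set (suc (c ⊔ ℓ)) where
  infix 4 _≈_
  field
    Carrier : Set c
    _≈_     : Rel Carrier ℓ
    _∨_     : Carrier → Carrier → Carrier
    _∧_     : Carrier → Carrier → Carrier
    compl   : Carrier → Carrier
    zero    : Carrier
    one     : Carrier
    cyl     : Fin 3 → Carrier → Carrier
    diag    : Fin 3 → Fin 3 → Carrier

module _ {c₁ ℓ₁ c₂ ℓ₂ : Level}
         (𝔐 : RawCylindricAlgebra c₁ ℓ₁) (𝔑 : RawCylindricAlgebra c₂ ℓ₂) where
  private
    module M = RawCylindricAlgebra 𝔐
    module N = RawCylindricAlgebra 𝔑

  record IsIsomorphism (f : M.Carrier → N.Carrier) : Set (c₁ ⊔ ℓ₁ ⊔ c₂ ⊔ ℓ₂) where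
    field
      cong       : ∀ {x y} → x M.≈ y → f x N.≈ f y
      ∨-homo     : ∀ x y → f (x M.∨ y) N.≈ f x N.∨ f y
      ∧-homo     : ∀ x y → f (x M.∧ y) N.≈ f x N.∧ f y
      compl-homo : ∀ x → f (M.compl x) N.≈ N.compl (f x)
      zero-homo  : f M.zero N.≈ N.zero
      one-homo   : f M.one N.≈ N.one
      cyl-homo   : ∀ κ x → f (M.cyl κ x) N.≈ N.cyl κ (f x)
      diag-homo  : ∀ κ ν → f (M.diag κ ν) N.≈ N.diag κ ν
      injective  : Injective M._≈_ N._≈_ f
      surjective : Surjective M._≈_ N._≈_ f

record 𝒫 {c e : Level} (S : Setoid c e) : Set (suc (c ⊔ e)) where
  constructor subset
  open Setoid S
  field
    pred : Pred Carrier (c ⊔ e)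
    resp : pred Respects _≈_

open 𝒫 public using (pred; resp)

module _ {c e : Level} {S : Setoid c e} where
  open Setoid S

  infix 4 _∈_ _≗_
  _∈_ : Carrier → 𝒫 S → Set (c ⊔ e)
  x ∈ X = pred X x

  _≗_ : Rel (𝒫 S) (c ⊔ e)
  X ≗ Y = pred X ≐ pred Y

  infixr 7 _∩_
  infixr 6 _∪_
  _∪_ _∩_ : 𝒫 S → 𝒫 S → 𝒫 S
  X ∪ Y = subset (λ x → x ∈ X ⊎ x ∈ Y)
    λ { x≈y (inj₁ x∈X) → inj₁ (resp X x≈y x∈X)
      ; x≈y (inj₂ x∈Y) → inj₂ (resp Y x≈y x∈Y) }
  X ∩ Y = subset (λ x → x ∈ X × x ∈ Y)
    λ { x≈y (x∈X , x∈Y) → resp X x≈y x∈X , resp Y x≈y x∈Y }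

  ∁ : 𝒫 S → 𝒫 S
  ∁ X = subset (λ x → ¬ x ∈ X) λ x≈y x∉X y∈X → x∉X (resp X (sym x≈y) y∈X)

  ∅ full : 𝒫 S
  ∅    = subset (λ _ → ⊥) λ _ ()
  full = subset (λ _ → ⊤) λ _ _ → tt

module _ {b ℓ : Level} (𝔅 : AtomStructure b ℓ) where
  open AtomStructure 𝔅

  T* : Fin 3 → 𝒫 setoid → 𝒫 setoid
  T* κ X = subset (λ y → ∃[ x ] x ∈ X × T κ y x)
    λ { y≈z (x , x∈X , Tyx) → x , x∈X , proj₂ (T-resp κ) y≈z Tyx }

  Eˢ : Fin 3 → Fin 3 → 𝒫 setoid
  Eˢ κ ν = subset (λ y → Lift b (E κ ν y))
    λ { y≈z (lift Ey) → lift (E-resp κ ν y≈z Ey) }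

  Cm : RawCylindricAlgebra (suc (b ⊔ ℓ)) (b ⊔ ℓ)
  Cm = record
    { Carrier = 𝒫 setoid
    ; _≈_     = _≗_
    ; _∨_     = _∪_
    ; _∧_     = _∩_
    ; compl   = ∁
    ; zero    = ∅
    ; one     = full
    ; cyl     = T*
    ; diag    = Eˢ
    }

module _ {u : Level} (U : Setoid u u) where
  open Setoid U

  Cube : Setoid u u
  Cube = ≋-setoid U 3

  C : Fin 3 → 𝒫 Cube → 𝒫 Cube
  C κ X = subset (λ v → ∃[ w ] w ∈ X × (∀ ν → ν ≢ κ → w ν ≈ v ν))
    λ { v≈v′ (w , w∈X , w≈v) →
        w , w∈X , λ ν ν≢κ → trans (w≈v ν ν≢κ) (v≈v′ ν) }

  D : Fin 3 → Fin 3 → 𝒫 Cube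
  D κ ν = subset (λ v → v κ ≈ v ν)
    λ v≈v′ vκ≈vν → trans (sym (v≈v′ κ)) (trans vκ≈vν (v≈v′ ν))

  -- The universe of the subalgebra completely generated by a family G.  The
  -- level of I is large enough to index every subset of 𝒫 Cube.  Since X is
  -- only required to be extensionally the union, ⋃-closed also makes
  -- membership independent of the representation of X.
  data Generated {g : Level} {J : Set g} (G : J → 𝒫 Cube)
                 : 𝒫 Cube → Set (g ⊔ suc (suc u)) where
    generator : ∀ j → Generated G (G j)
    ∪-closed  : ∀ {X Y} → Generated G X → Generated G Y → Generated G (X ∪ Y)
    ∁-closed  : ∀ {X} → Generated G X → Generated G (∁ X)
    C-closed  : ∀ κ {X} → Generated G X → Generated G (C κ X)
    D-closed  : ∀ κ ν → Generated G (D κ ν)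
    ⋃-closed  : {I : Set (suc u)} (F : I → 𝒫 Cube) → (∀ i → Generated G (F i)) →
                ∀ {X} → pred X ≐ ⋃ I (λ i → pred (F i)) → Generated G X

module _ {b ℓ : Level} (𝔅 : AtomStructure b ℓ) where
  open AtomStructure 𝔅 renaming (refl to ≈-refl; sym to ≈-sym; trans to ≈-trans)

  Step : Rel (B × Fin 3) ℓ
  Step (s , κ) (t , _) = ¬ s ≈ t × T κ s t

  record Trail : Set (b ⊔ ℓ) where
    field
      prefix    : List (B × Fin 3)
      end       : B
      lastIndex : Fin 3

    toList : List (B × Fin 3)
    toList = prefix ∷ʳ (end , lastIndex)

    field
      linked : Linked Step toList

  open Trail

  relabel : ∀ xs {t κ ν} → Linked Step (xs ∷ʳ (t , κ)) → Linked Step (xs ∷ʳ (t , ν))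
  relabel []           [-]        = [-]
  relabel (_ ∷ [])     (st ∷ [-]) = st ∷ [-]
  relabel (_ ∷ y ∷ xs) (st ∷ l)   = st ∷ relabel (y ∷ xs) l

  infixl 9 _⟨_⟩
  _⟨_⟩ : Trail → Fin 3 → Trail
  p ⟨ ν ⟩ = record
    { prefix    = prefix p
    ; end       = end p
    ; lastIndex = ν
    ; linked    = relabel (prefix p) (linked p)
    }

  -- The rule eq is needed because B is a setoid: it identifies trails that are
  -- equal as sequences.
  infix 4 _⇝_
  data _⇝_ : Rel (List (B × Fin 3)) (b ⊔ ℓ) where
    eq       : ∀ {xs ys} →
               Pointwise (λ (s , κ) (t , ν) → s ≈ t × κ ≡ ν) xs ys → xs ⇝ ys
    detour   : ∀ xs t ν s κ ys →
               xs ++ (t , ν) ∷ (s , ν) ∷ (t , κ) ∷ ys ⇝ xs ++ (t , κ) ∷ ys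
    truncate : ∀ xs t κ s ν → κ ≢ ν →
               xs ++ (t , κ) ∷ (s , ν) ∷ [] ⇝ xs ++ (t , ν) ∷ []
    diagonal : ∀ xs t ν κ → E ν κ t →
               xs ++ (t , ν) ∷ [] ⇝ xs ++ (t , κ) ∷ []

  Base : Setoid (b ⊔ ℓ) (b ⊔ ℓ)
  Base = EqClosure.setoid {A = Trail} (λ p q → toList p ⇝ toList q)

  private
    module U = Setoid Base
    W = 𝒫 (Cube Base)

  R[_] : B → W
  R[ t ] = subset (λ v → ∃[ p ] end p ≈ t × (∀ κ → v κ U.≈ p ⟨ κ ⟩))
    λ { v≈w (p , p-ends , v≈p) →
        p , p-ends , λ κ → U.trans (U.sym (v≈w κ)) (v≈p κ) }

  V : W
  V = subset (λ v → ∃[ t ] v ∈ R[ t ])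
    λ { v≈w (t , v∈Rt) → t , resp R[ t ] v≈w v∈Rt }

  R⋃ : 𝒫 setoid → W
  R⋃ X = subset (λ v → ∃[ t ] t ∈ X × v ∈ R[ t ])
    λ { v≈w (t , t∈X , v∈Rt) → t , t∈X , resp R[ t ] v≈w v∈Rt }

  ℭ : W → Set (suc (suc (b ⊔ ℓ)))
  ℭ = Generated Base R[_]

  record RcSet : Set (suc (suc (b ⊔ ℓ))) where
    constructor rcSet
    field
      set  : W
      in-ℭ : ℭ set
      ⊆V   : pred set ⊆ pred V

  open RcSet

  R⋃∈ℭ : ∀ X → ℭ (R⋃ X)
  R⋃∈ℭ X = ⋃-closed
    {I = Lift (suc (b ⊔ ℓ)) (Σ[ t ∈ B ] t ∈ X)} (λ (lift (t , _)) → R[ t ])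
    (λ (lift (t , _)) → generator t)
    ( (λ { (t , t∈X , v∈Rt) → lift (t , t∈X) , v∈Rt })
    , (λ { (lift (t , t∈X) , v∈Rt) → t , t∈X , v∈Rt }))

  V∈ℭ : ℭ V
  V∈ℭ = ⋃-closed {I = Lift (suc (b ⊔ ℓ)) B} (λ (lift t) → R[ t ])
    (λ (lift t) → generator t)
    ( (λ { (t , v∈Rt) → lift t , v∈Rt }) , (λ { (lift t , v∈Rt) → t , v∈Rt }))

  ∅∈ℭ : ℭ ∅
  ∅∈ℭ = ⋃-closed {I = ⊥} (λ ()) (λ ()) ((λ ()) , (λ ()))

  R : 𝒫 setoid → RcSet
  R X = rcSet (R⋃ X) (R⋃∈ℭ X) (λ { (t , _ , v∈Rt) → t , v∈Rt })

  -- ℭ is generated using union and complement only, so excluded middle is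
  -- needed for its closure under intersection.
  module _ (em : ExcludedMiddle (b ⊔ ℓ)) where

    ∩∈ℭ : ∀ {X Y} → ℭ X → ℭ Y → ℭ (X ∩ Y)
    ∩∈ℭ {X} {Y} cX cY = ⋃-closed {I = ⊤} (λ _ → ∁ (∁ X ∪ ∁ Y))
      (λ _ → ∁-closed (∪-closed (∁-closed cX) (∁-closed cY)))
      ( (λ { (v∈X , v∈Y) → tt , λ { (inj₁ v∉X) → v∉X v∈X ; (inj₂ v∉Y) → v∉Y v∈Y } })
      , (λ { (_ , h) → decidable-stable em (h ∘ inj₁) , decidable-stable em (h ∘ inj₂) }))

    Rc : RawCylindricAlgebra (suc (suc (b ⊔ ℓ))) (b ⊔ ℓ)
    Rc = record
      { Carrier = RcSet
      ; _≈_     = λ X Y → set X ≗ set Y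
      ; _∨_     = λ X Y → rcSet (set X ∪ set Y) (∪-closed (in-ℭ X) (in-ℭ Y))
                    λ { (inj₁ v∈X) → ⊆V X v∈X ; (inj₂ v∈Y) → ⊆V Y v∈Y }
      ; _∧_     = λ X Y → rcSet (set X ∩ set Y) (∩∈ℭ (in-ℭ X) (in-ℭ Y)) (⊆V X ∘ proj₁)
      ; compl   = λ X → relativize (∁-closed (in-ℭ X))
      ; zero    = rcSet ∅ ∅∈ℭ λ ()
      ; one     = rcSet V V∈ℭ λ v∈V → v∈V
      ; cyl     = λ κ X → relativize (C-closed κ (in-ℭ X))
      ; diag    = λ κ ν → relativize (D-closed κ ν)
      }
      where
      relativize : ∀ {X} → ℭ X → RcSet
      relativize {X} cX = rcSet (V ∩ X) (∩∈ℭ V∈ℭ cX) proj₁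

{-# OPTIONS --safe #-}
-- A triple is read as a triangle with edges labelled by atoms.  A trail glues
-- triangles along edges; cancelling backtracking makes the triangles along a
-- trail into a tree, and a point of the base is a vertex of a triangle of the
-- tree, identified with the vertices of the neighbouring triangles along the
-- glued edges.  An edge whose two endpoints are represented in two triangles has
-- the same label in both, because it is carried down the tree to a common
-- ancestor; this gives the disjointness of the sets R[ t ] and the two
-- inclusions about cylindrifications and diagonals that are not immediate.
--
-- For surjectivity, prepending a step to the trails that start at one of its
-- ends is an involution of the base that preserves every R[ t ], hence every
-- member of ℭ.  Such involutions move any triple of R[ t ] to the triple of the
-- one-point trail at t, so every member of ℭ below V is a union of sets R[ t ].
module Submission where

open import Level using (Level; _⊔_; suc; Lift; lift; lower)
open import Axiom.ExcludedMiddle using (ExcludedMiddle)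
open import Defs

open import Algebra.Bundles using (CommutativeSemigroup)
open import Data.Bool.Base using (true; false; if_then_else_)
open import Data.Fin.Base using (Fin)
open import Data.Fin.Patterns using (0F; 1F; 2F)
open import Data.Fin.Properties using (_≟_; _<?_; all?)
open import Data.List.Base using (List; []; _∷_; _∷ʳ_; foldl; length)
open import Data.List.Properties using (++-assoc; foldl-++; foldl-∷ʳ)
open import Data.List.Relation.Binary.Pointwise as Pointwise using ([]; _∷_; Pointwise-length)
open import Data.List.Relation.Unary.Linked using (Linked; [-]; _∷_)
open import Data.Nat.Base as ℕ using ()
open import Data.Product.Base using (_×_; _,_; proj₁; proj₂; ∃-syntax)
open import Data.Product.Relation.Binary.Pointwise.NonDependent using (×-setoid)
open import Data.Sum.Base using (_⊎_; inj₁; inj₂)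
open import Data.Unit.Polymorphic using (⊤; tt)
open import Function.Base using (_∘_)
open import Function.Bundles using (_⇔_; mk⇔; Equivalence)
open import Function.Construct.Composition using (_⇔-∘_)
open import Function.Construct.Identity using (⇔-id)
open import Function.Construct.Symmetry using (⇔-sym)
open import Relation.Binary.Bundles using (Setoid; Poset)
open import Relation.Binary.Construct.Closure.Symmetric using (fwd)
open import Relation.Binary.Core using (Rel)
open import Relation.Binary.Definitions using (Decidable)
open import Relation.Binary.PropositionalEquality.Core as ≡ using (_≡_; _≢_; refl; ≢-sym)
open import Relation.Binary.Structures using (IsEquivalence)
open import Relation.Nullary using (¬_; yes; no; does; contradiction)
open import Relation.Nullary.Decidable using (map′; from-yes; _→-dec_; _×-dec_; ¬?)
open import Relation.Unary using (Pred; _⊆_)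
import Algebra.Properties.CommutativeSemigroup as CommutativeSemigroupProperties
import Data.Nat.Properties as ℕₚ
import Relation.Binary.Construct.Closure.Equivalence as EqClosure
import Relation.Binary.Construct.Closure.ReflexiveTransitive as Star
import Relation.Binary.PropositionalEquality.Properties as ≡
import Relation.Binary.Reasoning.PartialOrder as PosetReasoning
import Relation.Binary.Reasoning.Setoid as SetoidReasoning

-- Boolean algebra from Huntington's equation.

module WAProperties {a ℓ : Level} (𝔄 : WA a ℓ) where
  open WA 𝔄

  setoid : Setoid a ℓ
  setoid = record { isEquivalence = isEquivalence }

  private
    +-commutativeSemigroup : CommutativeSemigroup a ℓ
    +-commutativeSemigroup = record
      { isCommutativeSemigroup = record
        { isSemigroup = record
          { isMagma = record { isEquivalence = isEquivalence ; ∙-cong = +-cong }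
          ; assoc   = λ x y z → ≈-sym (+-assoc x y z)
          }
        ; comm = +-comm
        }
      }
    open CommutativeSemigroupProperties +-commutativeSemigroup using (interchange)
    module ≈-Reasoning = SetoidReasoning setoid

  +-congˡ : ∀ {x y z} → y ≈ z → x + y ≈ x + z
  +-congˡ = +-cong ≈-refl

  +-congʳ : ∀ {x y z} → y ≈ z → y + x ≈ z + x
  +-congʳ y≈z = +-cong y≈z ≈-refl

  -‿cong-comm : ∀ x y → - (x + y) ≈ - (y + x)
  -‿cong-comm x y = -‿cong (+-comm x y)

  -- Huntington's equation splits x, - x, y and - y into the same four pieces.
  +-inverse-unique : ∀ x y → x + - x ≈ y + - y
  +-inverse-unique x y = begin
    x + - x
      ≈⟨ +-cong (huntington x (- y)) (huntington (- x) (- y)) ⟨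
    (- (- x + - - y) + - (- x + - y)) + (- (- - x + - - y) + - (- - x + - y))
      ≈⟨ interchange _ _ _ _ ⟩
    (- (- x + - - y) + - (- - x + - - y)) + (- (- x + - y) + - (- - x + - y))
      ≈⟨ +-comm _ _ ⟩
    (- (- x + - y) + - (- - x + - y)) + (- (- x + - - y) + - (- - x + - - y))
      ≈⟨ +-cong (+-comm _ _) (+-comm _ _) ⟩
    (- (- - x + - y) + - (- x + - y)) + (- (- - x + - - y) + - (- x + - - y))
      ≈⟨ +-cong (+-cong (-‿cong-comm _ _) (-‿cong-comm _ _))
                (+-cong (-‿cong-comm _ _) (-‿cong-comm _ _)) ⟩
    (- (- y + - - x) + - (- y + - x)) + (- (- - y + - - x) + - (- - y + - x))
      ≈⟨ +-cong (huntington y (- x)) (huntington (- y) (- x)) ⟩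
    y + - y
      ∎
    where open ≈-Reasoning

  +-inverseʳ : ∀ x → x + - x ≈ 1#
  +-inverseʳ x = +-inverse-unique x 1′

  +-inverseˡ : ∀ x → - x + x ≈ 1#
  +-inverseˡ x = ≈-trans (+-comm _ _) (+-inverseʳ x)

  -- Splitting `- - x` along `- x` and `x` along `- - x` gives the same two pieces: the sum
  -- `- x + - - - x` occurs in both, and the other sum is `1#` each time.
  -‿involutive : ∀ x → - - x ≈ x
  -‿involutive x = begin
    - - x                                      ≈⟨ huntington (- - x) (- x) ⟨
    - (- - - x + - - x) + - (- - - x + - x)    ≈⟨ +-comm _ _ ⟩
    - (- - - x + - x) + - (- - - x + - - x)    ≈⟨ +-cong (-‿cong-comm _ _) (-‿cong inverses-≈) ⟩
    - (- x + - - - x) + - (- x + - - x)        ≈⟨ huntington x (- - x) ⟩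
    x                                          ∎
    where
    open ≈-Reasoning
    inverses-≈ : - - - x + - - x ≈ - x + - - x
    inverses-≈ = ≈-trans (+-inverseˡ (- - x)) (≈-sym (+-inverseʳ (- x)))

  -- With `c = - (1# + 1#)`, Huntington's equation at `0#` shows that `0#` absorbs `c`. Then
  -- `1# ≈ 1# + 0#` absorbs `c` too, so `1# + 1#` equals its own sum with `c`, which is `1#`.
  1#+1#≈1# : 1# + 1# ≈ 1#
  1#+1#≈1# = begin
    1# + 1#                    ≈⟨ +-congˡ 1#≈1#+c ⟩
    1# + (1# + - (1# + 1#))    ≈⟨ +-assoc _ _ _ ⟩
    (1# + 1#) + - (1# + 1#)    ≈⟨ +-inverseʳ _ ⟩
    1#                         ∎
    where
    open ≈-Reasoning
    0#+c≈0# : 0# + - (1# + 1#) ≈ 0#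
    0#+c≈0# = begin
      - 1# + - (1# + 1#)
        ≈⟨ +-comm _ _ ⟩
      - (1# + 1#) + - 1#
        ≈⟨ +-cong (-‿cong (+-cong (-‿involutive _) (-‿involutive _))) (-‿cong (+-inverseˡ 0#)) ⟨
      - (- 0# + - 0#) + - (- 0# + 0#)
        ≈⟨ huntington 0# 0# ⟩
      0#
        ∎
    1#≈1#+c : 1# ≈ 1# + - (1# + 1#)
    1#≈1#+c = begin
      1#                           ≈⟨ +-inverseʳ 1# ⟨
      1# + 0#                      ≈⟨ +-congˡ 0#+c≈0# ⟨
      1# + (0# + - (1# + 1#))      ≈⟨ +-assoc _ _ _ ⟩
      (1# + 0#) + - (1# + 1#)      ≈⟨ +-congʳ (+-inverseʳ 1#) ⟩
      1# + - (1# + 1#)             ∎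

  0#+0#≈0# : 0# + 0# ≈ 0#
  0#+0#≈0# = begin
    - 1# + - 1#                        ≈⟨ +-cong (-‿cong doubled-1#) (-‿cong (+-inverseˡ 0#)) ⟨
    - (- 0# + - 0#) + - (- 0# + 0#)    ≈⟨ huntington 0# 0# ⟩
    0#                                 ∎
    where
    open ≈-Reasoning
    doubled-1# : - - 1# + - - 1# ≈ 1#
    doubled-1# = ≈-trans (+-cong (-‿involutive _) (-‿involutive _)) 1#+1#≈1#

  -- Writes every element as a sum with `0#`, so that idempotence of `0#` makes `0#` neutral.
  -[-x+-x]+0#≈x : ∀ x → - (- x + - x) + 0# ≈ x
  -[-x+-x]+0#≈x x = ≈-trans (+-congˡ (-‿cong (≈-sym (+-inverseˡ x)))) (huntington x x)

  +-identityʳ : ∀ x → x + 0# ≈ x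
  +-identityʳ x = begin
    x + 0#                           ≈⟨ +-congʳ (-[-x+-x]+0#≈x x) ⟨
    (- (- x + - x) + 0#) + 0#        ≈⟨ +-assoc _ _ _ ⟨
    - (- x + - x) + (0# + 0#)        ≈⟨ +-congˡ 0#+0#≈0# ⟩
    - (- x + - x) + 0#               ≈⟨ -[-x+-x]+0#≈x x ⟩
    x                                ∎
    where open ≈-Reasoning

  +-idem : ∀ x → x + x ≈ x
  +-idem x = begin
    x + x                        ≈⟨ -‿involutive _ ⟨
    - - (x + x)                  ≈⟨ -‿cong (-‿cong (+-cong (-‿involutive x) (-‿involutive x))) ⟨
    - - (- - x + - - x)          ≈⟨ -‿cong (+-identityʳ _) ⟨
    - (- (- - x + - - x) + 0#)   ≈⟨ -‿cong (-[-x+-x]+0#≈x (- x)) ⟩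
    - - x                        ≈⟨ -‿involutive x ⟩
    x                            ∎
    where open ≈-Reasoning

  ≤-reflexive : ∀ {x y} → x ≈ y → x ≤ y
  ≤-reflexive x≈y = ≈-trans (+-congʳ x≈y) (+-idem _)

  ≤-trans : ∀ {x y z} → x ≤ y → y ≤ z → x ≤ z
  ≤-trans x≤y y≤z = ≈-trans (+-congˡ (≈-sym y≤z))
    (≈-trans (+-assoc _ _ _) (≈-trans (+-congʳ x≤y) y≤z))

  ≤-antisym : ∀ {x y} → x ≤ y → y ≤ x → x ≈ y
  ≤-antisym x≤y y≤x = ≈-trans (≈-sym y≤x) (≈-trans (+-comm _ _) x≤y)

  poset : Poset a ℓ ℓ
  poset = record
    { isPartialOrder = record
      { isPreorder = record
        { isEquivalence = isEquivalence ; reflexive = ≤-reflexive ; trans = ≤-trans }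
      ; antisym = ≤-antisym
      }
    }

  private module ≤-Reasoning = PosetReasoning poset

  x≤x+y : ∀ x y → x ≤ x + y
  x≤x+y x y = ≈-trans (+-assoc x x y) (+-congʳ (+-idem x))

  y≤x+y : ∀ x y → y ≤ x + y
  y≤x+y x y = ≤-trans (x≤x+y y x) (≤-reflexive (+-comm y x))

  +-lub : ∀ {x y z} → x ≤ z → y ≤ z → x + y ≤ z
  +-lub x≤z y≤z = ≈-trans (≈-sym (+-assoc _ _ _)) (≈-trans (+-congˡ y≤z) x≤z)

  x≤1# : ∀ x → x ≤ 1#
  x≤1# x = ≤-trans (x≤x+y x (- x)) (≤-reflexive (+-inverseʳ x))

  -- If `x ≤ y`, one of the two pieces into which Huntington's equation cuts `- x` along `y` is
  -- `- y`.
  -‿antitone : ∀ {x y} → x ≤ y → - y ≤ - x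
  -‿antitone {x} {y} x≤y = begin
    - y                              ≤⟨ y≤x+y _ _ ⟩
    - (- - x + - y) + - y            ≈⟨ +-congˡ (-‿cong (≈-trans (+-congʳ (-‿involutive x)) x≤y)) ⟨
    - (- - x + - y) + - (- - x + y)  ≈⟨ huntington (- x) y ⟩
    - x                              ∎
    where open ≤-Reasoning

  -‿antitoneʳ : ∀ {x y} → x ≤ - y → y ≤ - x
  -‿antitoneʳ x≤-y = ≤-trans (≤-reflexive (≈-sym (-‿involutive _))) (-‿antitone x≤-y)

  x≤-x⇒x≈0# : ∀ {x} → x ≤ - x → x ≈ 0#
  x≤-x⇒x≈0# {x} x≤-x = begin
    x          ≈⟨ -‿involutive x ⟨
    - - x      ≈⟨ -‿cong x≤-x ⟨
    - (x + - x) ≈⟨ -‿cong (+-inverseʳ x) ⟩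
    0#         ∎
    where open ≈-Reasoning

  x·y≤x : ∀ x y → x · y ≤ x
  x·y≤x x y = ≤-trans (-‿antitone (x≤x+y (- x) (- y))) (≤-reflexive (-‿involutive x))

  x·y≤y : ∀ x y → x · y ≤ y
  x·y≤y x y = ≤-trans (-‿antitone (y≤x+y (- x) (- y))) (≤-reflexive (-‿involutive y))

  x≤y⇒x·y≈x : ∀ {x y} → x ≤ y → x · y ≈ x
  x≤y⇒x·y≈x x≤y =
    ≈-trans (-‿cong (≈-trans (+-comm _ _) (-‿antitone x≤y))) (-‿involutive _)

  x·y≈0#⇒x≤-y : ∀ {x y} → x · y ≈ 0# → x ≤ - y
  x·y≈0#⇒x≤-y {x} {y} x·y≈0# = begin
    x                            ≈⟨ huntington x y ⟨
    x · y + - (- x + y)          ≈⟨ +-congʳ x·y≈0# ⟩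
    0# + - (- x + y)             ≈⟨ +-comm _ _ ⟩
    - (- x + y) + 0#             ≈⟨ +-identityʳ _ ⟩
    - (- x + y)                  ≤⟨ -‿antitone (y≤x+y (- x) y) ⟩
    - y                          ∎
    where open ≤-Reasoning

  -- Arithmetic of converse and composition.

  ˘-mono : ∀ {x y} → x ≤ y → x ˘ ≤ y ˘
  ˘-mono x≤y = ≈-trans (≈-sym (˘-+ _ _)) (˘-cong x≤y)

  ˘-swapˡ : ∀ {x y} → x ˘ ≤ y → x ≤ y ˘
  ˘-swapˡ x˘≤y = ≤-trans (≤-reflexive (≈-sym (˘-involutive _))) (˘-mono x˘≤y)

  ˘-swapʳ : ∀ {x y} → x ≤ y ˘ → x ˘ ≤ y
  ˘-swapʳ x≤y˘ = ≤-trans (˘-mono x≤y˘) (≤-reflexive (˘-involutive _))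

  ⨾-monoˡ : ∀ {x y} z → x ≤ y → x ⨾ z ≤ y ⨾ z
  ⨾-monoˡ z x≤y = ≈-trans (≈-sym (⨾-distribʳ-+ _ _ z)) (⨾-cong x≤y ≈-refl)

  ⨾-distribˡ-+ : ∀ x y z → x ⨾ (y + z) ≈ x ⨾ y + x ⨾ z
  ⨾-distribˡ-+ x y z = begin
    x ⨾ (y + z)                  ≈⟨ ˘-involutive _ ⟨
    (x ⨾ (y + z)) ˘ ˘            ≈⟨ ˘-cong (≈-trans (˘-⨾ _ _) (⨾-cong (˘-+ y z) ≈-refl)) ⟩
    ((y ˘ + z ˘) ⨾ x ˘) ˘        ≈⟨ ˘-cong (⨾-distribʳ-+ _ _ _) ⟩
    (y ˘ ⨾ x ˘ + z ˘ ⨾ x ˘) ˘    ≈⟨ ˘-cong (+-cong (˘-⨾ x y) (˘-⨾ x z)) ⟨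
    ((x ⨾ y) ˘ + (x ⨾ z) ˘) ˘    ≈⟨ ˘-cong (˘-+ _ _) ⟨
    (x ⨾ y + x ⨾ z) ˘ ˘          ≈⟨ ˘-involutive _ ⟩
    x ⨾ y + x ⨾ z                ∎
    where open ≈-Reasoning

  ⨾-monoʳ : ∀ {x y} z → x ≤ y → z ⨾ x ≤ z ⨾ y
  ⨾-monoʳ z x≤y = ≈-trans (≈-sym (⨾-distribˡ-+ z _ _)) (⨾-cong ≈-refl x≤y)

  -- The product `1′ ˘ ⨾ 1′` equals `1′ ˘` and is its own converse.
  1′˘≈1′ : 1′ ˘ ≈ 1′
  1′˘≈1′ = begin
    1′ ˘              ≈⟨ ⨾-identityʳ (1′ ˘) ⟨
    1′ ˘ ⨾ 1′         ≈⟨ ⨾-cong ≈-refl (˘-involutive 1′) ⟨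
    1′ ˘ ⨾ 1′ ˘ ˘     ≈⟨ ˘-⨾ (1′ ˘) 1′ ⟨
    (1′ ˘ ⨾ 1′) ˘     ≈⟨ ˘-cong (⨾-identityʳ _) ⟩
    1′ ˘ ˘            ≈⟨ ˘-involutive 1′ ⟩
    1′                ∎
    where open ≈-Reasoning

  ⨾-identityˡ : ∀ x → 1′ ⨾ x ≈ x
  ⨾-identityˡ x = begin
    1′ ⨾ x            ≈⟨ ˘-involutive _ ⟨
    (1′ ⨾ x) ˘ ˘      ≈⟨ ˘-cong (˘-⨾ 1′ x) ⟩
    (x ˘ ⨾ 1′ ˘) ˘    ≈⟨ ˘-cong (⨾-cong ≈-refl 1′˘≈1′) ⟩
    (x ˘ ⨾ 1′) ˘      ≈⟨ ˘-cong (⨾-identityʳ _) ⟩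
    x ˘ ˘             ≈⟨ ˘-involutive x ⟩
    x                 ∎
    where open ≈-Reasoning

  x≤1′⇒x⨾y≤y : ∀ {x} y → x ≤ 1′ → x ⨾ y ≤ y
  x≤1′⇒x⨾y≤y y x≤1′ = ≤-trans (⨾-monoˡ y x≤1′) (≤-reflexive (⨾-identityˡ y))

  x≤1′⇒x˘≤1′ : ∀ {x} → x ≤ 1′ → x ˘ ≤ 1′
  x≤1′⇒x˘≤1′ x≤1′ = ≤-trans (˘-mono x≤1′) (≤-reflexive 1′˘≈1′)

  x≤x⨾1# : ∀ x → x ≤ x ⨾ 1#
  x≤x⨾1# x = ≤-trans (≤-reflexive (≈-sym (⨾-identityʳ x))) (⨾-monoʳ x (x≤1# 1′))

  -- Weak associativity enters here: `u ⨾ 1#` absorbs a further factor `1#`, so a bound `u` on the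
  -- domain of `y` also bounds the domain of whatever lies below `y ⨾ z`.
  domain-⨾ : ∀ {u x y z} → u ≤ 1′ → x ≤ y ⨾ z → y ≤ u ⨾ 1# → x ≤ u ⨾ 1#
  domain-⨾ {u} {x} {y} {z} u≤1′ x≤y⨾z y≤u⨾1# = begin
    x                        ≤⟨ x≤y⨾z ⟩
    y ⨾ z                    ≤⟨ ⨾-monoˡ z y≤u⨾1# ⟩
    (u ⨾ 1#) ⨾ z             ≤⟨ ⨾-monoʳ (u ⨾ 1#) (x≤1# z) ⟩
    (u ⨾ 1#) ⨾ 1#            ≈⟨ ⨾-cong (⨾-cong (x≤y⇒x·y≈x u≤1′) ≈-refl) ≈-refl ⟨
    ((u · 1′) ⨾ 1#) ⨾ 1#     ≈⟨ ⨾-weak-assoc u ⟩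
    (u · 1′) ⨾ 1#            ≈⟨ ⨾-cong (x≤y⇒x·y≈x u≤1′) ≈-refl ⟩
    u ⨾ 1#                   ∎
    where open ≤-Reasoning

  -- Atoms: cycle laws and domains.

  ˘-atom : ∀ {x} → IsAtom x → IsAtom (x ˘)
  ˘-atom {x} (x≉0 , minimal) =
      (λ x˘≈0 → x≉0 (≈-trans (≈-sym (˘-involutive x)) (≈-trans (˘-cong x˘≈0) 0#˘≈0#)))
    , λ y y≤x˘ y≉0 → ≈-trans (≈-sym (˘-involutive y)) (˘-cong
        (minimal (y ˘) (˘-swapʳ y≤x˘) λ y˘≈0 → y≉0
          (≈-trans (≈-sym (˘-involutive y)) (≈-trans (˘-cong y˘≈0) 0#˘≈0#))))
    where
    0#≤ : ∀ y → 0# ≤ y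
    0#≤ y = ≈-trans (+-comm 0# y) (+-identityʳ y)
    0#˘≈0# : 0# ˘ ≈ 0#
    0#˘≈0# = ≤-antisym (˘-swapʳ (0#≤ _)) (0#≤ _)

  atom-resp : ∀ {x y} → x ≈ y → IsAtom x → IsAtom y
  atom-resp x≈y (x≉0 , minimal) =
      (λ y≈0 → x≉0 (≈-trans x≈y y≈0))
    , λ z z≤y z≉0 → ≈-trans
        (minimal z (≤-trans z≤y (≤-reflexive (≈-sym x≈y))) z≉0) x≈y

  atom-≤⇒≈ : ∀ {x y} → IsAtom x → IsAtom y → x ≤ y → x ≈ y
  atom-≤⇒≈ (x≉0 , _) (_ , minimal) x≤y = minimal _ x≤y x≉0

  module _ (em : ExcludedMiddle ℓ) where

    atom-dichotomy : ∀ {x} → IsAtom x → ∀ y → x ≤ y ⊎ x ≤ - y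
    atom-dichotomy {x} (_ , minimal) y with em {x · y ≈ 0#}
    ... | yes x·y≈0 = inj₂ (x·y≈0#⇒x≤-y x·y≈0)
    ... | no  x·y≉0 = inj₁ (≤-trans
      (≤-reflexive (≈-sym (minimal (x · y) (x·y≤x x y) x·y≉0))) (x·y≤y x y))

    -- Otherwise the atom `y` lies below `- (x ˘ ⨾ z)`, and Tarski's axiom puts `x ⨾ y`, hence `z`,
    -- below `- z`.
    cycleˡ : ∀ {x y z} → IsAtom y → ¬ z ≈ 0# → z ≤ x ⨾ y → y ≤ x ˘ ⨾ z
    cycleˡ {x} {y} {z} y-atom z≉0 z≤x⨾y with atom-dichotomy y-atom (x ˘ ⨾ z)
    ... | inj₁ y≤ = y≤
    ... | inj₂ y≤ = contradiction (x≤-x⇒x≈0# (begin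
      z                          ≤⟨ z≤x⨾y ⟩
      x ⨾ y                      ≤⟨ ⨾-monoʳ x y≤ ⟩
      x ⨾ - (x ˘ ⨾ z)            ≈⟨ ⨾-cong (˘-involutive x) ≈-refl ⟨
      x ˘ ˘ ⨾ - (x ˘ ⨾ z)        ≤⟨ tarski (x ˘) z ⟩
      - z                        ∎)) z≉0
      where open ≤-Reasoning

    -- The mirror image of `cycleˡ` under converse.
    cycleʳ : ∀ {x y z} → IsAtom x → IsAtom z → z ≤ x ⨾ y → x ≤ z ⨾ y ˘
    cycleʳ {x} {y} {z} x-atom z-atom z≤x⨾y = begin
      x                      ≤⟨ ˘-swapˡ (cycleˡ (˘-atom x-atom) (proj₁ (˘-atom z-atom))
                                  (≤-trans (˘-mono z≤x⨾y) (≤-reflexive (˘-⨾ x y)))) ⟩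
      (y ˘ ˘ ⨾ z ˘) ˘        ≈⟨ ˘-cong (˘-⨾ z (y ˘)) ⟨
      (z ⨾ y ˘) ˘ ˘          ≈⟨ ˘-involutive _ ⟩
      z ⨾ y ˘                ∎
      where open ≤-Reasoning

    -- Cut `1#` into `v` and `- v`. Multiplying by `u` on the left does not lead out of `- v`, so if
    -- `u ⨾ v` also missed `v`, then all of `u ⨾ 1#` would.
    domain-of-subidentity : ∀ {u v} → u ≤ 1′ → IsAtom v → v ≤ u ⨾ 1# → v ≤ u ⨾ v
    domain-of-subidentity {u} {v} u≤1′ v-atom v≤u⨾1# with atom-dichotomy v-atom (u ⨾ v)
    ... | inj₁ v≤ = v≤
    ... | inj₂ v≤ = contradiction (x≤-x⇒x≈0# (begin
      v                      ≤⟨ v≤u⨾1# ⟩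
      u ⨾ 1#                 ≈⟨ ⨾-cong ≈-refl (+-inverseʳ v) ⟨
      u ⨾ (v + - v)          ≈⟨ ⨾-distribˡ-+ u v (- v) ⟩
      u ⨾ v + u ⨾ - v        ≤⟨ +-lub (-‿antitoneʳ v≤) (x≤1′⇒x⨾y≤y (- v) u≤1′) ⟩
      - v                    ∎)) (proj₁ v-atom)
      where open ≤-Reasoning

    domain-unique : ∀ {u v} → IsAtom u → u ≤ 1′ → IsAtom v → v ≤ 1′ → v ≤ u ⨾ 1# → v ≈ u
    domain-unique {u} {v} u-atom u≤1′ v-atom v≤1′ v≤u⨾1# = atom-≤⇒≈ v-atom u-atom (begin
      v             ≤⟨ domain-of-subidentity u≤1′ v-atom v≤u⨾1# ⟩
      u ⨾ v         ≤⟨ ⨾-monoʳ u v≤1′ ⟩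
      u ⨾ 1′        ≈⟨ ⨾-identityʳ u ⟩
      u             ∎)
      where open ≤-Reasoning

    -- The cycle law turns `v ≤ v ⨾ v` into `v ≤ v ˘ ⨾ v`, which lies below the atom `v ˘`.
    subidentity-˘ : ∀ {v} → IsAtom v → v ≤ 1′ → v ˘ ≈ v
    subidentity-˘ {v} v-atom v≤1′ = ≈-sym (atom-≤⇒≈ v-atom (˘-atom v-atom) (begin
      v             ≤⟨ cycleˡ v-atom (proj₁ v-atom) (domain-of-subidentity v≤1′ v-atom (x≤x⨾1# v)) ⟩
      v ˘ ⨾ v       ≤⟨ ⨾-monoʳ (v ˘) v≤1′ ⟩
      v ˘ ⨾ 1′      ≈⟨ ⨾-identityʳ _ ⟩
      v ˘           ∎))
      where open ≤-Reasoning

-- Triangles and the labels of their sides.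

third : Fin 3 → Fin 3 → Fin 3
third 0F 1F = 2F
third 1F 0F = 2F
third 0F 2F = 1F
third 2F 0F = 1F
-- The true value for the vertices 1 and 2 in either order, and junk on equal arguments.
third _  _  = 0F

third-unique : ∀ i j μ → i ≢ j → i ≢ μ → j ≢ μ → third i j ≡ μ
third-unique = from-yes (all? λ i → all? λ j → all? λ μ →
  ¬? (i ≟ j) →-dec (¬? (i ≟ μ) →-dec (¬? (j ≟ μ) →-dec (third i j ≟ μ))))

third-≢ˡ : ∀ i j → i ≢ j → i ≢ third i j
third-≢ˡ = from-yes (all? λ i → all? λ j → ¬? (i ≟ j) →-dec ¬? (i ≟ third i j))

third-≢ʳ : ∀ i j → i ≢ j → j ≢ third i j
third-≢ʳ = from-yes (all? λ i → all? λ j → ¬? (i ≟ j) →-dec ¬? (j ≟ third i j))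

module EdgeLabels {a ℓ : Level} (em : ExcludedMiddle ℓ) (𝔄 : WA a ℓ) where
  open WA 𝔄
  open WAProperties 𝔄
  open AtomStructure (suitableStructure 𝔄) using (T; E; B) renaming (_≈_ to _≈ᴮ_)

  infix 10 _at_
  _at_ : B → Fin 3 → Carrier
  _at_ = _!_ 𝔄

  at-atom : ∀ s κ → IsAtom (s at κ)
  at-atom s κ = At.isAtom (Triple.atom s κ)

  orient : Fin 3 → Fin 3 → Carrier → Carrier
  orient i j x = if does (j <? i) then x ˘ else x

  orient-cong : ∀ i j {x y} → x ≈ y → orient i j x ≈ orient i j y
  orient-cong i j x≈y with does (j <? i)
  ... | true  = ˘-cong x≈y
  ... | false = x≈y

  orient-atom : ∀ i j {x} → IsAtom x → IsAtom (orient i j x)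
  orient-atom i j x-atom with does (j <? i)
  ... | true  = ˘-atom x-atom
  ... | false = x-atom

  orient-≤1′ : ∀ i j {x} → x ≤ 1′ ⇔ orient i j x ≤ 1′
  orient-≤1′ i j with does (j <? i)
  ... | true  = mk⇔ x≤1′⇒x˘≤1′ λ x˘≤1′ →
    ≤-trans (≤-reflexive (≈-sym (˘-involutive _))) (x≤1′⇒x˘≤1′ x˘≤1′)
  ... | false = ⇔-id _

  -- A triple s is the triangle on the vertices 0, 1, 2 whose edges 0 → 1,
  -- 1 → 2 and 0 → 2 are labelled s₂, s₀ and s₁.  The value at i ≡ j is junk.
  edge : B → Fin 3 → Fin 3 → Carrier
  edge s i j = orient i j (s at third i j)

  edge-atom : ∀ s i j → IsAtom (edge s i j)
  edge-atom s i j = orient-atom i j (at-atom s (third i j))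

  edge-˘ : ∀ s i j → i ≢ j → edge s i j ˘ ≈ edge s j i
  edge-˘ s 0F 0F i≢j = contradiction refl i≢j
  edge-˘ s 0F 1F i≢j = ≈-refl
  edge-˘ s 0F 2F i≢j = ≈-refl
  edge-˘ s 1F 0F i≢j = ˘-involutive _
  edge-˘ s 1F 1F i≢j = contradiction refl i≢j
  edge-˘ s 1F 2F i≢j = ≈-refl
  edge-˘ s 2F 0F i≢j = ˘-involutive _
  edge-˘ s 2F 1F i≢j = ˘-involutive _
  edge-˘ s 2F 2F i≢j = contradiction refl i≢j

  -- `T μ` compares the labels at `μ`, which belong to the edge opposite the vertex `μ`; related
  -- triangles are glued along that edge.
  edge-T : ∀ s t μ i j → i ≢ j → i ≢ μ → j ≢ μ → T μ s t → edge s i j ≈ edge t i j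
  edge-T s t μ i j i≢j i≢μ j≢μ sTt with refl ← third-unique i j μ i≢j i≢μ j≢μ =
    orient-cong i j sTt

  E⇔edge≤1′ : ∀ s i j → i ≢ j → E i j s ⇔ edge s i j ≤ 1′
  E⇔edge≤1′ s i j i≢j = orient-≤1′ i j ⇔-∘ mk⇔
    (λ { same → contradiction refl i≢j
       ; (distinct μ _ μ≢i μ≢j sμ≤1′) →
           ≡.subst (λ ν → s at ν ≤ 1′)
             (≡.sym (third-unique i j μ i≢j (≢-sym μ≢i) (≢-sym μ≢j))) sμ≤1′ })
    (distinct (third i j) i≢j (≢-sym (third-≢ˡ i j i≢j)) (≢-sym (third-≢ʳ i j i≢j)))

  E-sym : ∀ s {i j} → E i j s → E j i s
  E-sym s same                          = same
  E-sym s (distinct μ i≢j μ≢i μ≢j h) = distinct μ (≢-sym i≢j) μ≢j μ≢i h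

  -- One case is the cycle condition of the triple, two follow from it by the cycle laws for atoms,
  -- and the reversed edges follow by converse.
  edge-triangle : ∀ s i j → i ≢ j →
                  edge s i j ≤ edge s i (third i j) ⨾ edge s (third i j) j
  edge-triangle s 0F 0F i≢j = contradiction refl i≢j
  edge-triangle s 1F 1F i≢j = contradiction refl i≢j
  edge-triangle s 2F 2F i≢j = contradiction refl i≢j
  edge-triangle s 0F 2F _ = Triple.cycle s
  edge-triangle s 2F 0F _ = ≤-trans (˘-mono (Triple.cycle s)) (≤-reflexive (˘-⨾ _ _))
  edge-triangle s 0F 1F _ = cycleʳ em (at-atom s 2F) (at-atom s 1F) (Triple.cycle s)
  edge-triangle s 1F 2F _ =
    cycleˡ em (at-atom s 0F) (proj₁ (at-atom s 1F)) (Triple.cycle s)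
  edge-triangle s 1F 0F _ = ≤-trans (˘-mono (edge-triangle s 0F 1F λ ()))
    (≤-reflexive (≈-trans (˘-⨾ _ _) (⨾-cong (˘-involutive _) ≈-refl)))
  edge-triangle s 2F 1F _ = ≤-trans (˘-mono (edge-triangle s 1F 2F λ ()))
    (≤-reflexive (≈-trans (˘-⨾ _ _) (⨾-cong ≈-refl (˘-involutive _))))

  edge-via : ∀ s i k j → i ≢ j → i ≢ k → j ≢ k → edge s i j ≤ edge s i k ⨾ edge s k j
  edge-via s i k j i≢j i≢k j≢k with refl ← third-unique i j k i≢j i≢k j≢k =
    edge-triangle s i j i≢j

  -- For distinct vertices, the triangle inequality puts the edge from `i` to `k` below a product of
  -- two subidentities.
  E-trans : ∀ s {i j k} → E i j s → E j k s → E i k s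
  E-trans s {i} {j} {k} Eij Ejk with i ≟ k | i ≟ j | j ≟ k
  ... | yes refl | _        | _        = same
  ... | no _     | yes refl | _        = Ejk
  ... | no _     | no _     | yes refl = Eij
  ... | no i≢k   | no i≢j   | no j≢k   = from (E⇔edge≤1′ s i k i≢k)
    (≤-trans (edge-via s i j k i≢k i≢j (≢-sym j≢k))
    (≤-trans (x≤1′⇒x⨾y≤y _ (to (E⇔edge≤1′ s i j i≢j) Eij))
             (to (E⇔edge≤1′ s j k j≢k) Ejk)))
    where open Equivalence

  E-T : ∀ s t μ {i j} → i ≢ μ → j ≢ μ → T μ s t → E i j s → E i j t
  E-T s t μ {i} {j} i≢μ j≢μ sTt Eij with i ≟ j
  ... | yes refl = same
  ... | no  i≢j  = from (E⇔edge≤1′ t i j i≢j)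
    (≤-trans (≤-reflexive (≈-sym (edge-T s t μ i j i≢j i≢μ j≢μ sTt)))
             (to (E⇔edge≤1′ s i j i≢j) Eij))
    where open Equivalence

  -- The loop at vertex i is labelled by the atom below 1′ that is the domain of
  -- the edges leaving i.  Loops are needed because the two endpoints of an edge
  -- can represent the same point of the base.
  data Label (s : B) (i : Fin 3) : Fin 3 → Pred Carrier (a ⊔ ℓ) where
    loop : ∀ {w} → IsAtom w → w ≤ 1′ → (∀ k → i ≢ k → edge s i k ≤ w ⨾ 1#) →
           Label s i i w
    side : ∀ {j w} → i ≢ j → w ≈ edge s i j → Label s i j w

  -- Invariance of labels under gluing and identification of vertices.

  Edge : Set (a ⊔ ℓ)
  Edge = B × Fin 3 × Fin 3

  LabelOf : Edge → Pred Carrier (a ⊔ ℓ)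
  LabelOf (s , i , j) = Label s i j

  infix 4 _∼_
  -- Comparing the sets of admissible labels avoids choosing the atom on a loop or proving that
  -- there is one.
  _∼_ : Rel Edge (a ⊔ ℓ)
  x ∼ y = ∀ w → LabelOf x w ⇔ LabelOf y w

  ∼-isEquivalence : IsEquivalence _∼_
  ∼-isEquivalence = record
    { refl  = λ w → ⇔-id _
    ; sym   = λ x∼y w → ⇔-sym (x∼y w)
    ; trans = λ x∼y y∼z w → y∼z w ⇔-∘ x∼y w
    }

  label-resp : ∀ {s i j w w′} → w ≈ w′ → Label s i j w → Label s i j w′
  label-resp w≈w′ (loop w-atom w≤1′ dom) =
    loop (atom-resp w≈w′ w-atom) (≤-trans (≤-reflexive (≈-sym w≈w′)) w≤1′)
      λ k i≢k → ≤-trans (dom k i≢k) (≤-reflexive (⨾-cong w≈w′ ≈-refl))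
  label-resp w≈w′ (side i≢j w≈) = side i≢j (≈-trans (≈-sym w≈w′) w≈)

  -- One edge leaving `i` suffices: the other lies below a product starting with it, and `domain-⨾`
  -- carries the domain over.
  loop-from-edge : ∀ {s i w} k → IsAtom w → w ≤ 1′ → i ≢ k → edge s i k ≤ w ⨾ 1# →
                   Label s i i w
  loop-from-edge {s} {i} {w} k w-atom w≤1′ i≢k dom = loop w-atom w≤1′ dom′
    where
    dom′ : ∀ j → i ≢ j → edge s i j ≤ w ⨾ 1#
    dom′ j i≢j with j ≟ k
    ... | yes refl = dom
    ... | no  j≢k  = domain-⨾ w≤1′ (edge-via s i k j i≢j i≢k j≢k) dom

  label-flip : ∀ {s i j w w′} → w ˘ ≈ w′ → Label s i j w → Label s j i w′
  label-flip w˘≈w′ L@(loop w-atom w≤1′ _) =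
    label-resp (≈-trans (≈-sym (subidentity-˘ em w-atom w≤1′)) w˘≈w′) L
  label-flip {s} {i} {j} w˘≈w′ (side i≢j w≈) = side (≢-sym i≢j)
    (≈-trans (≈-sym w˘≈w′) (≈-trans (˘-cong w≈) (edge-˘ s i j i≢j)))

  ∼-flip : ∀ {s i j t k l} → (s , i , j) ∼ (t , k , l) → (s , j , i) ∼ (t , l , k)
  ∼-flip s∼t w = mk⇔
    (λ L → label-flip (˘-involutive w) (to (s∼t (w ˘)) (label-flip ≈-refl L)))
    (λ L → label-flip (˘-involutive w) (from (s∼t (w ˘)) (label-flip ≈-refl L)))
    where open Equivalence

  label-T : ∀ s t μ {i j w} → i ≢ μ → j ≢ μ → T μ s t → Label s i j w → Label t i j w
  -- Gluing guarantees agreement on just one edge leaving `i`, the one that avoids `μ`;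
  -- `loop-from-edge` supplies the other.
  label-T s t μ {i} i≢μ _ sTt (loop w-atom w≤1′ dom) =
    loop-from-edge k w-atom w≤1′ i≢k (≤-trans
      (≤-reflexive (≈-sym (edge-T s t μ i k i≢k i≢μ (≢-sym (third-≢ʳ i μ i≢μ)) sTt)))
      (dom k i≢k))
    where
    k = third i μ
    i≢k = third-≢ˡ i μ i≢μ
  label-T s t μ i≢μ j≢μ sTt (side i≢j w≈) =
    side i≢j (≈-trans w≈ (edge-T s t μ _ _ i≢j i≢μ j≢μ sTt))

  ∼-T : ∀ s t μ {i j} → i ≢ μ → j ≢ μ → T μ s t → (s , i , j) ∼ (t , i , j)
  ∼-T s t μ i≢μ j≢μ sTt w =
    mk⇔ (label-T s t μ i≢μ j≢μ sTt) (label-T t s μ i≢μ j≢μ (≈-sym sTt))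

  label-≈ : ∀ {s t i j w} → s ≈ᴮ t → Label s i j w → Label t i j w
  label-≈ {i = i} s≈t (loop w-atom w≤1′ dom) = loop w-atom w≤1′ λ k i≢k →
    ≤-trans (≤-reflexive (orient-cong i k (≈-sym (s≈t _)))) (dom k i≢k)
  label-≈ {i = i} {j} s≈t (side i≢j w≈) =
    side i≢j (≈-trans w≈ (orient-cong i j (s≈t _)))

  ∼-≈ : ∀ {s t i j} → s ≈ᴮ t → (s , i , j) ∼ (t , i , j)
  ∼-≈ s≈t w = mk⇔ (label-≈ s≈t) (label-≈ λ κ → ≈-sym (s≈t κ))

  -- Moving the endpoint to a different vertex `i′` opens a loop into a side, labelled by the loop's
  -- atom because of `domain-unique`. A side ending at `i′` closes into a loop. Any other side keeps
  -- its label: the triangle inequality gives one inclusion, and both labels are atoms.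
  label-E : ∀ {s i i′ j w} → E i i′ s → Label s i j w → Label s i′ j w
  label-E same L = L
  label-E {s} {i} {i′} {_} {w} Eii′@(distinct _ i≢i′ _ _ _) (loop w-atom w≤1′ dom) =
    label-flip (subidentity-˘ em w-atom w≤1′) (side i≢i′ (≈-sym
      (domain-unique em w-atom w≤1′ (edge-atom s i i′)
        (Equivalence.to (E⇔edge≤1′ s i i′ i≢i′) Eii′) (dom i′ i≢i′))))
  label-E {s} {i} {i′} {j} {w} Eii′@(distinct _ i≢i′ _ _ _) (side i≢j w≈) with i′ ≟ j
  ... | no i′≢j = side i′≢j (≈-trans w≈ (atom-≤⇒≈ (edge-atom s i j) (edge-atom s i′ j)
    (≤-trans (edge-via s i i′ j i≢j i≢i′ (≢-sym i′≢j))
      (x≤1′⇒x⨾y≤y _ (Equivalence.to (E⇔edge≤1′ s i i′ i≢i′) Eii′)))))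
  ... | yes refl = label-resp (≈-sym w≈) (loop-from-edge i v-atom v≤1′ (≢-sym i≢i′)
    (≤-trans (≤-reflexive (≈-trans (≈-sym (edge-˘ s i i′ i≢i′)) (subidentity-˘ em v-atom v≤1′)))
             (x≤x⨾1# _)))
    where
    v-atom = edge-atom s i i′
    v≤1′ = Equivalence.to (E⇔edge≤1′ s i i′ i≢i′) Eii′

  ∼-E : ∀ {s i i′ j} → E i i′ s → (s , i , j) ∼ (s , i′ , j)
  ∼-E Eii′ w = mk⇔ (label-E Eii′) (label-E (E-sym _ Eii′))

  label-unique : ∀ {s i j w} → i ≢ j → Label s i j w → w ≈ edge s i j
  label-unique i≢j (loop _ _ _) = contradiction refl i≢j
  label-unique i≢j (side _ w≈)  = w≈

  side-≈ : ∀ {s t} i j → i ≢ j → (s , i , j) ∼ (t , i , j) → edge s i j ≈ edge t i j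
  side-≈ i j i≢j s∼t = label-unique i≢j (Equivalence.to (s∼t _) (side i≢j ≈-refl))

  ∼⇒T : ∀ κ s t → (∀ i j → i ≢ κ → j ≢ κ → (s , i , j) ∼ (t , i , j)) → T κ s t
  ∼⇒T 0F s t s∼t = side-≈ 1F 2F (λ ()) (s∼t 1F 2F (λ ()) (λ ()))
  ∼⇒T 1F s t s∼t = side-≈ 0F 2F (λ ()) (s∼t 0F 2F (λ ()) (λ ()))
  ∼⇒T 2F s t s∼t = side-≈ 0F 1F (λ ()) (s∼t 0F 1F (λ ()) (λ ()))

-- Atom structures with abstract edge labels.

module _ {b ℓ : Level} (𝔅 : AtomStructure b ℓ) where
  open AtomStructure 𝔅 using (B; _≈_; T; T-resp)

  Node : Set b
  Node = B × Fin 3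

  T-resp-≈ : ∀ {κ s s′ t t′} → s ≈ s′ → t ≈ t′ → T κ s t → T κ s′ t′
  T-resp-≈ {κ} s≈s′ t≈t′ sTt = proj₁ (T-resp κ) t≈t′ (proj₂ (T-resp κ) s≈s′ sTt)

-- Collects what the argument about trails uses of the algebra; `_∼_` stands for carrying the same
-- label, and `∼⇒T` recovers gluability from labels.
record Labelling {b ℓ : Level} (𝔅 : AtomStructure b ℓ) (r : Level) : Set (b ⊔ ℓ ⊔ suc r) where
  open AtomStructure 𝔅 using (B; _≈_; T; E)

  field
    T-sym   : ∀ κ s t → T κ s t → T κ t s
    T-joint : ∀ s t → (∀ κ → T κ s t) → s ≈ t
    E-refl  : ∀ s i → E i i s
    E-sym   : ∀ s {i j} → E i j s → E j i s
    E-trans : ∀ s {i j k} → E i j s → E j k s → E i k s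
    E-T     : ∀ s t μ {i j} → i ≢ μ → j ≢ μ → T μ s t → E i j s → E i j t

  infix 4 _∼_
  field
    _∼_             : Rel (B × Fin 3 × Fin 3) r
    ∼-isEquivalence : IsEquivalence _∼_
    ∼-flip          : ∀ {s i j t k l} → (s , i , j) ∼ (t , k , l) → (s , j , i) ∼ (t , l , k)
    ∼-≈             : ∀ {s t i j} → s ≈ t → (s , i , j) ∼ (t , i , j)
    ∼-E             : ∀ {s i k j} → E i k s → (s , i , j) ∼ (s , k , j)
    ∼-T             : ∀ s t μ {i j} → i ≢ μ → j ≢ μ → T μ s t → (s , i , j) ∼ (t , i , j)
    ∼⇒T             : ∀ κ s t → (∀ i j → i ≢ κ → j ≢ κ → (s , i , j) ∼ (t , i , j)) → T κ s t

  open IsEquivalence ∼-isEquivalence public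
    renaming (refl to ∼-refl; sym to ∼-sym; trans to ∼-trans)

  ∼-Eʳ : ∀ {s i j l} → E j l s → (s , i , j) ∼ (s , i , l)
  ∼-Eʳ Ejl = ∼-flip (∼-E Ejl)

-- Reduced walks and the points they denote.

module Walks {b ℓ r : Level} {𝔅 : AtomStructure b ℓ} (L : Labelling 𝔅 r)
             (_≈?_ : Decidable (AtomStructure._≈_ 𝔅)) where
  open Labelling L
  open AtomStructure 𝔅 using (B; _≈_; T; E; E-resp)
    renaming (setoid to B-setoid; refl to ≈-refl; sym to ≈-sym; trans to ≈-trans)
  open Trail

  open Setoid (Pointwise.setoid (×-setoid B-setoid (≡.setoid (Fin 3)))) using ()
    renaming (_≈_ to _≋_; refl to ≋-refl; sym to ≋-sym; trans to ≋-trans)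

  -- Reading a trail from left to right while cancelling backtracking.  The
  -- reduced trail is kept in reverse order.
  advance : List (Node 𝔅) → B → B × List (Node 𝔅)
  advance []                         t = t , []
  advance (x ∷ [])                   t = t , x ∷ []
  advance ((s , ν) ∷ (u , μ) ∷ xs) t with (μ ≟ ν) ×-dec (u ≈? t)
  ... | yes _ = u , xs
  ... | no  _ = t , (s , ν) ∷ (u , μ) ∷ xs

  feed : List (Node 𝔅) → Node 𝔅 → List (Node 𝔅)
  feed xs (t , κ) = (proj₁ (advance xs t) , κ) ∷ proj₂ (advance xs t)

  walk : List (Node 𝔅) → List (Node 𝔅)
  walk = foldl feed []

  advance-≈ : ∀ xs t → proj₁ (advance xs t) ≈ t
  advance-≈ []                         t = ≈-refl
  advance-≈ (x ∷ [])                   t = ≈-refl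
  advance-≈ ((s , ν) ∷ (u , μ) ∷ xs) t with (μ ≟ ν) ×-dec (u ≈? t)
  ... | yes (_ , u≈t) = u≈t
  ... | no  _         = ≈-refl

  feed-cong : ∀ {xs ys t u κ} → xs ≋ ys → t ≈ u → feed xs (t , κ) ≋ feed ys (u , κ)
  feed-cong []        t≈u = (t≈u , refl) ∷ []
  feed-cong (e ∷ []) t≈u = (t≈u , refl) ∷ e ∷ []
  feed-cong {(_ , ν) ∷ (v , μ) ∷ _} {(_ , _) ∷ (w , _) ∷ _} {t} {u}
            ((s≈ , refl) ∷ (v≈w , refl) ∷ xs≋ys) t≈u
    with (μ ≟ ν) ×-dec (v ≈? t) | (μ ≟ ν) ×-dec (w ≈? u)
  ... | yes _           | yes _           = (v≈w , refl) ∷ xs≋ys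
  ... | yes (μ≡ν , v≈t) | no  ¬p          =
    contradiction (μ≡ν , ≈-trans (≈-sym v≈w) (≈-trans v≈t t≈u)) ¬p
  ... | no  ¬p          | yes (μ≡ν , w≈u) =
    contradiction (μ≡ν , ≈-trans v≈w (≈-trans w≈u (≈-sym t≈u))) ¬p
  ... | no  _           | no  _           =
    (t≈u , refl) ∷ (s≈ , refl) ∷ (v≈w , refl) ∷ xs≋ys

  foldl-feed-cong : ∀ {xs ys us vs} → xs ≋ ys → us ≋ vs → foldl feed xs us ≋ foldl feed ys vs
  foldl-feed-cong xs≋ys []                      = xs≋ys
  foldl-feed-cong xs≋ys ((u≈v , refl) ∷ us≋vs) =
    foldl-feed-cong (feed-cong xs≋ys u≈v) us≋vs

  Reduced : B → List (Node 𝔅) → Set ℓ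
  Reduced t []                         = ⊤
  Reduced t (x ∷ [])                   = ⊤
  Reduced t ((u , μ) ∷ (v , ν) ∷ xs) = ¬ (ν ≡ μ × v ≈ t) × Reduced u ((v , ν) ∷ xs)

  Reduced′ : List (Node 𝔅) → Set ℓ
  Reduced′ []             = ⊤
  Reduced′ ((t , _) ∷ xs) = Reduced t xs

  feed-reduced : ∀ xs x → Reduced′ xs → Reduced′ (feed xs x)
  feed-reduced []                         _       _ = tt
  feed-reduced (x ∷ [])                   _       _ = tt
  feed-reduced ((s , ν) ∷ (u , μ) ∷ xs) (t , _) red with (μ ≟ ν) ×-dec (u ≈? t)
  ... | no  ¬p = ¬p , red
  feed-reduced (_ ∷ _ ∷ [])     _ _         | yes _ = tt
  feed-reduced (_ ∷ _ ∷ _ ∷ _) _ (_ , red) | yes _ = red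

  foldl-feed-reduced : ∀ xs ys → Reduced′ xs → Reduced′ (foldl feed xs ys)
  foldl-feed-reduced xs []       red = red
  foldl-feed-reduced xs (y ∷ ys) red = foldl-feed-reduced _ ys (feed-reduced xs y red)

  -- The step to `s` is either pushed and cancelled on return, or it cancels the last step, which
  -- the return then restores. In the second case reducedness keeps the return from cancelling once
  -- more.
  feed-detour : ∀ t′ xs t s ν κ → Reduced t′ xs → t′ ≈ t →
                feed (feed ((t′ , ν) ∷ xs) (s , ν)) (t , κ) ≋ (t′ , κ) ∷ xs
  feed-detour t′ [] t s ν κ _ t′≈t with (ν ≟ ν) ×-dec (t′ ≈? t)
  ... | yes _ = ≋-refl
  ... | no ¬p = contradiction (refl , t′≈t) ¬p
  feed-detour t′ ((u , μ) ∷ xs) t s ν κ red t′≈t with (μ ≟ ν) ×-dec (u ≈? s)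
  feed-detour t′ ((u , μ) ∷ xs) t s ν κ red t′≈t | no _
    with (ν ≟ ν) ×-dec (t′ ≈? t)
  ... | yes _ = ≋-refl
  ... | no ¬p = contradiction (refl , t′≈t) ¬p
  feed-detour t′ ((u , μ) ∷ []) t s ν κ red t′≈t | yes (μ≡ν , _) =
    (≈-sym t′≈t , refl) ∷ (≈-refl , ≡.sym μ≡ν) ∷ []
  feed-detour t′ ((u , μ) ∷ (v , ρ) ∷ xs) t s ν κ (¬p , _) t′≈t | yes (μ≡ν , _)
    with (ρ ≟ ν) ×-dec (v ≈? t)
  ... | yes (ρ≡ν , v≈t) =
    contradiction (≡.trans ρ≡ν (≡.sym μ≡ν) , ≈-trans v≈t (≈-sym t′≈t)) ¬p
  ... | no  _           = (≈-sym t′≈t , refl) ∷ (≈-refl , ≡.sym μ≡ν) ∷ ≋-refl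

  Valid : B → List (Node 𝔅) → Set ℓ
  Valid t []             = ⊤
  Valid t ((u , μ) ∷ xs) = T μ u t × Valid u xs

  Valid′ : List (Node 𝔅) → Set ℓ
  Valid′ []             = ⊤
  Valid′ ((t , _) ∷ xs) = Valid t xs

  Valid-resp : ∀ {s t xs ys} → s ≈ t → xs ≋ ys → Valid s xs → Valid t ys
  Valid-resp s≈t []                      _           = tt
  Valid-resp s≈t ((u≈v , refl) ∷ xs≋ys) (uTs , val) =
    T-resp-≈ 𝔅 u≈v s≈t uTs , Valid-resp u≈v xs≋ys val

  feed-valid : ∀ s ν xs t κ → T ν s t → Valid s xs → Valid′ (feed ((s , ν) ∷ xs) (t , κ))
  feed-valid s ν []             t κ sTt val = sTt , val
  feed-valid s ν ((u , μ) ∷ xs) t κ sTt val with (μ ≟ ν) ×-dec (u ≈? t)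
  ... | yes _ = proj₂ val
  ... | no  _ = sTt , val

  foldl-feed-valid : ∀ {s ν s′ xs ys} → s ≈ s′ → Valid s′ xs → Linked (Step 𝔅) ((s , ν) ∷ ys) →
                     Valid′ (foldl feed ((s′ , ν) ∷ xs) ys)
  foldl-feed-valid s≈s′ val [-] = val
  foldl-feed-valid {ν = ν} {s′} {xs} s≈s′ val (_∷_ {y = t , κ} (_ , sTt) linked) =
    foldl-feed-valid (≈-sym (advance-≈ ((s′ , ν) ∷ xs) t))
      (feed-valid s′ ν xs t κ (T-resp-≈ 𝔅 s≈s′ ≈-refl sTt) val) linked

  -- Computed without `lastIndex`, so the trails `p ⟨ κ ⟩` share one reduced triangle and stack.
  -- Cancelling keeps the earlier copy of a triangle, hence only `top p ≈ end p`.
  top : Trail 𝔅 → B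
  top p = proj₁ (advance (walk (prefix p)) (end p))

  stack : Trail 𝔅 → List (Node 𝔅)
  stack p = proj₂ (advance (walk (prefix p)) (end p))

  top≈end : ∀ p → top p ≈ end p
  top≈end p = advance-≈ (walk (prefix p)) (end p)

  walk-toList : ∀ p → walk (toList p) ≡ (top p , lastIndex p) ∷ stack p
  walk-toList p = foldl-∷ʳ feed [] _ (prefix p)

  trail-valid : ∀ p → Valid (top p) (stack p)
  trail-valid p = ≡.subst Valid′ (walk-toList p) (walk-valid (toList p) (linked p))
    where
    walk-valid : ∀ xs → Linked (Step 𝔅) xs → Valid′ (walk xs)
    walk-valid []       _   = tt
    walk-valid (x ∷ xs) lnk = foldl-feed-valid ≈-refl tt lnk

  -- A nonempty list (t , i) ∷ xs denotes the vertex i of the triangle t glued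
  -- on at the end of the reverse of xs.
  infix 4 _≃_ _↓_ _⋈_
  data _≃_ : Rel (List (Node 𝔅)) (b ⊔ ℓ) where
    []    : [] ≃ []
    _∥_∷_ : ∀ {s t i j xs ys} → s ≈ t → E i j s → xs ≋ ys → (s , i) ∷ xs ≃ (t , j) ∷ ys

  ≋⇒≃ : ∀ {x y} → x ≋ y → x ≃ y
  ≋⇒≃ []                      = []
  ≋⇒≃ ((s≈t , refl) ∷ xs≋ys) = s≈t ∥ E-refl _ _ ∷ xs≋ys

  ≃-sym : ∀ {x y} → x ≃ y → y ≃ x
  ≃-sym []                 = []
  ≃-sym (s≈t ∥ Eij ∷ xs≋ys) = ≈-sym s≈t ∥ E-resp _ _ s≈t (E-sym _ Eij) ∷ ≋-sym xs≋ys

  ≃-trans : ∀ {x y z} → x ≃ y → y ≃ z → x ≃ z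
  ≃-trans []                 []                 = []
  ≃-trans (s≈t ∥ Eij ∷ xs≋ys) (t≈u ∥ Ejk ∷ ys≋zs) =
    ≈-trans s≈t t≈u ∥ E-trans _ Eij (E-resp _ _ (≈-sym s≈t) Ejk) ∷ ≋-trans xs≋ys ys≋zs

  ≃-length : ∀ {x y} → x ≃ y → length x ≡ length y
  ≃-length []              = refl
  ≃-length (_ ∥ _ ∷ xs≋ys) = ≡.cong ℕ.suc (Pointwise-length xs≋ys)

  -- A vertex other than the one moved by the last step already belongs to the
  -- previous triangle.
  data _↓_ : Rel (List (Node 𝔅)) (b ⊔ ℓ) where
    stop : ∀ {x y} → x ≃ y → x ↓ y
    drop : ∀ {s i j u μ xs y} → E i j s → j ≢ μ → (u , j) ∷ xs ↓ y →
           (s , i) ∷ (u , μ) ∷ xs ↓ y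

  ≃-↓-trans : ∀ {x y z} → x ≃ y → y ↓ z → x ↓ z
  ≃-↓-trans x≃y (stop y≃z) = stop (≃-trans x≃y y≃z)
  ≃-↓-trans (s≈t ∥ Eij ∷ ((u≈v , refl) ∷ xs≋ys)) (drop Ejk k≢μ d) =
    drop (E-trans _ Eij (E-resp _ _ (≈-sym s≈t) Ejk)) k≢μ
      (≃-↓-trans (u≈v ∥ E-refl _ _ ∷ xs≋ys) d)

  ↓-trans : ∀ {x y z} → x ↓ y → y ↓ z → x ↓ z
  ↓-trans (stop x≃y)     e = ≃-↓-trans x≃y e
  ↓-trans (drop Eij j≢μ d) e = drop Eij j≢μ (↓-trans d e)

  ↓-length : ∀ {x y} → x ↓ y → length y ℕ.≤ length x
  ↓-length (stop x≃y)   = ℕₚ.≤-reflexive (≡.sym (≃-length x≃y))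
  ↓-length (drop _ _ d) = ℕₚ.m≤n⇒m≤1+n (↓-length d)

  ↓-valid : ∀ {x y} → x ↓ y → Valid′ x → Valid′ y
  ↓-valid (stop [])                  _         = tt
  ↓-valid (stop (s≈t ∥ _ ∷ xs≋ys)) val       = Valid-resp s≈t xs≋ys val
  ↓-valid (drop _ _ d)               (_ , val) = ↓-valid d val

  -- Descents of one point form a chain, which makes `_⋈_` transitive. If both drop, the vertices
  -- `j` and `j′` are identified in `s` and lie on the glued edge, so they are identified in `u` as
  -- well.
  ↓-compare : ∀ {x x′ y y′} → x ≃ x′ → Valid′ x → x ↓ y → x′ ↓ y′ → y ↓ y′ ⊎ y′ ↓ y
  ↓-compare x≃x′ val (stop x≃y) d′ = inj₁ (≃-↓-trans (≃-trans (≃-sym x≃y) x≃x′) d′)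
  ↓-compare x≃x′ val d (stop x′≃y′) =
    inj₂ (≃-↓-trans (≃-sym (≃-trans x≃x′ x′≃y′)) d)
  ↓-compare (s≈s′ ∥ Eii′ ∷ ((u≈u′ , refl) ∷ xs≋)) (uTs , val)
            (drop Eij j≢μ d) (drop Ei′j′ j′≢μ d′) =
    ↓-compare (u≈u′ ∥ E-T _ _ _ j≢μ j′≢μ (T-sym _ _ _ uTs) Ejj′ ∷ xs≋) val d d′
    where
    Ejj′ = E-trans _ (E-trans _ (E-sym _ Eij) Eii′) (E-resp _ _ (≈-sym s≈s′) Ei′j′)

  -- Identifications in the lower triangle lift back along the glued edges. A `stop` and a `drop`
  -- cannot share a target, by length.
  ↓-injective : ∀ {s i j xs y} → Valid s xs → (s , i) ∷ xs ↓ y → (s , j) ∷ xs ↓ y → E i j s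
  ↓-injective _ (stop (s≈t ∥ Eik ∷ _)) (stop (_ ∥ Ejk ∷ _)) = E-trans _ Eik (E-sym _ Ejk)
  ↓-injective _ (stop x≃y) (drop _ _ d) =
    contradiction (↓-length d) (ℕₚ.<⇒≱ (ℕₚ.≤-reflexive (≃-length x≃y)))
  ↓-injective _ (drop _ _ d) (stop x≃y) =
    contradiction (↓-length d) (ℕₚ.<⇒≱ (ℕₚ.≤-reflexive (≃-length x≃y)))
  ↓-injective (uTs , val) (drop Eik k≢μ d) (drop Ejl l≢μ e) =
    E-trans _ Eik (E-trans _ (E-T _ _ _ k≢μ l≢μ uTs (↓-injective val d e)) (E-sym _ Ejl))

  -- As long as both endpoints drop, the edge between them is the glued one and keeps its label. The
  -- length bound lets the second endpoint accompany the first down to `t`.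
  ↓-factor : ∀ {s i j xs t k ys z} → Valid s xs → (s , i) ∷ xs ↓ (t , k) ∷ ys →
             (s , j) ∷ xs ↓ z → length z ℕ.≤ length ((t , k) ∷ ys) →
             ∃[ l ] ((t , l) ∷ ys ↓ z) × (s , i , j) ∼ (t , k , l)
  ↓-factor {j = j} _ (stop (s≈t ∥ Eik ∷ xs≋ys)) e _ =
      j
    , ≃-↓-trans (≃-sym (s≈t ∥ E-refl _ _ ∷ xs≋ys)) e
    , ∼-trans (∼-E Eik) (∼-≈ s≈t)
  ↓-factor _ (drop _ _ d) (stop x≃z) z≤y = contradiction
    (ℕₚ.≤-trans (ℕₚ.≤-reflexive (≃-length x≃z)) (ℕₚ.≤-trans z≤y (↓-length d)))
    ℕₚ.1+n≰n
  ↓-factor (uTs , val) (drop Eik k≢μ d) (drop Ejl l≢μ e) z≤y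
    with m , f , h ← ↓-factor val d e z≤y =
      m , f
    , ∼-trans (∼-E Eik) (∼-trans (∼-Eʳ Ejl)
        (∼-trans (∼-T _ _ _ k≢μ l≢μ (T-sym _ _ _ uTs)) h))

  ∷↓[] : ∀ {x xs} → ¬ (x ∷ xs ↓ [])
  ∷↓[] (drop _ _ d) = ∷↓[] d

  -- Meeting at a common ancestor: the invariant by which points of the base are told apart.
  _⋈_ : Rel (List (Node 𝔅)) (b ⊔ ℓ)
  x ⋈ y = ∃[ z ] x ↓ z × y ↓ z

  ⋈-trans : ∀ {x y z} → Valid′ y → x ⋈ y → y ⋈ z → x ⋈ z
  ⋈-trans val (u , x↓u , y↓u) (v , y↓v , z↓v)
    with ↓-compare (≋⇒≃ ≋-refl) val y↓u y↓v
  ... | inj₁ u↓v = v , ↓-trans x↓u u↓v , z↓v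
  ... | inj₂ v↓u = u , x↓u , ↓-trans z↓v v↓u

  ⋈⇒E : ∀ {s i j xs} → Valid s xs → (s , i) ∷ xs ⋈ (s , j) ∷ xs → E i j s
  ⋈⇒E val (_ , d , e) = ↓-injective val d e

  -- Both edges are carried to the triangle of `y`, the meeting point farther from the root. There
  -- their second endpoints both descend to `z`, so `↓-injective` identifies them.
  ↓-∼ : ∀ {s i j xs t k l ys y z} → Valid s xs → Valid t ys →
        (s , i) ∷ xs ↓ y → (t , k) ∷ ys ↓ y → (s , j) ∷ xs ↓ z → (t , l) ∷ ys ↓ z →
        length z ℕ.≤ length y → (s , i , j) ∼ (t , k , l)
  ↓-∼ {y = []}     _   _    d _  _ _  _   = contradiction d ∷↓[]
  ↓-∼ {y = _ ∷ _} val val′ d d′ e e′ z≤y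
    with m  , f  , h  ← ↓-factor val d e z≤y
       | m′ , f′ , h′ ← ↓-factor val′ d′ e′ z≤y =
    ∼-trans h (∼-trans (∼-Eʳ (↓-injective (↓-valid d val) f f′)) (∼-sym h′))

  ⋈⇒∼ : ∀ {s i j xs t k l ys} → Valid s xs → Valid t ys →
        (s , i) ∷ xs ⋈ (t , k) ∷ ys → (s , j) ∷ xs ⋈ (t , l) ∷ ys →
        (s , i , j) ∼ (t , k , l)
  ⋈⇒∼ val val′ (y , d , d′) (z , e , e′) with ℕₚ.≤-total (length z) (length y)
  ... | inj₁ z≤y = ↓-∼ val val′ d d′ e e′ z≤y
  ... | inj₂ y≤z = ∼-flip (↓-∼ val val′ e e′ d d′ y≤z)

  ↓⇒⋈ : ∀ {x y} → x ↓ y → x ⋈ y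
  ↓⇒⋈ x↓y = _ , x↓y , stop (≋⇒≃ ≋-refl)

  ⋈-sym : ∀ {x y} → x ⋈ y → y ⋈ x
  ⋈-sym (z , x↓z , y↓z) = z , y↓z , x↓z

  -- As `κ ≢ ν`, the vertex `ν` lies on the glued edge. The two sides are one drop apart, downwards
  -- from `s` if it is pushed and downwards from `t` if the step cancels.
  walk-truncate : ∀ xs t s κ ν → κ ≢ ν →
                  feed ((t , κ) ∷ xs) (s , ν) ⋈ (t , ν) ∷ xs
  walk-truncate []             t s κ ν κ≢ν =
    ↓⇒⋈ (drop (E-refl _ _) (≢-sym κ≢ν) (stop (≋⇒≃ ≋-refl)))
  walk-truncate ((u , μ) ∷ xs) t s κ ν κ≢ν with (μ ≟ κ) ×-dec (u ≈? s)
  ... | yes (refl , _) =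
    ⋈-sym (↓⇒⋈ (drop (E-refl _ _) (≢-sym κ≢ν) (stop (≋⇒≃ ≋-refl))))
  ... | no  _          = ↓⇒⋈ (drop (E-refl _ _) (≢-sym κ≢ν) (stop (≋⇒≃ ≋-refl)))

  ⇝⇒⋈ : ∀ {xs ys} → _⇝_ 𝔅 xs ys → walk xs ⋈ walk ys
  ⇝⇒⋈ (eq xs≋ys) = ↓⇒⋈ (stop (≋⇒≃ (foldl-feed-cong [] xs≋ys)))
  ⇝⇒⋈ (detour xs t ν s κ ys)
    rewrite foldl-++ feed [] xs ((t , ν) ∷ (s , ν) ∷ (t , κ) ∷ ys)
          | foldl-++ feed [] xs ((t , κ) ∷ ys) =
    ↓⇒⋈ (stop (≋⇒≃ (foldl-feed-cong {us = ys}
      (feed-detour _ _ t s ν κ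
        (feed-reduced (walk xs) (t , ν) (foldl-feed-reduced [] xs tt))
        (advance-≈ (walk xs) t))
      ≋-refl)))
  ⇝⇒⋈ (truncate xs t κ s ν κ≢ν)
    rewrite foldl-++ feed [] xs ((t , κ) ∷ (s , ν) ∷ [])
          | foldl-++ feed [] xs ((t , ν) ∷ []) =
    walk-truncate _ _ s κ ν κ≢ν
  ⇝⇒⋈ (diagonal xs t ν κ Eνκ)
    rewrite foldl-++ feed [] xs ((t , ν) ∷ [])
          | foldl-++ feed [] xs ((t , κ) ∷ []) =
    ↓⇒⋈ (stop (≈-refl ∥ E-resp _ _ (≈-sym (advance-≈ (walk xs) t)) Eνκ ∷ ≋-refl))

  open Setoid (Base 𝔅) using () renaming (_≈_ to _≈ᵁ_)

  ≈ᵁ⇒⋈ : ∀ {p q} → p ≈ᵁ q →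
         (top p , lastIndex p) ∷ stack p ⋈ (top q , lastIndex q) ∷ stack q
  ≈ᵁ⇒⋈ = EqClosure.fold isEquivalence λ {p} {q} p⇝q →
    ≡.subst₂ _⋈_ (walk-toList p) (walk-toList q) (⇝⇒⋈ p⇝q)
    where
    isEquivalence : IsEquivalence λ p q →
      (top p , lastIndex p) ∷ stack p ⋈ (top q , lastIndex q) ∷ stack q
    isEquivalence = record
      { refl  = ↓⇒⋈ (stop (≋⇒≃ ≋-refl))
      ; sym   = ⋈-sym
      ; trans = λ {_} {q} → ⋈-trans (trail-valid q)
      }

  ≈ᵁ⇒E : ∀ p {i j} → _⟨_⟩ 𝔅 p i ≈ᵁ _⟨_⟩ 𝔅 p j → E i j (end p)
  ≈ᵁ⇒E p pi≈pj = E-resp _ _ (top≈end p) (⋈⇒E (trail-valid p) (≈ᵁ⇒⋈ pi≈pj))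

  -- The two vertices other than `κ` are common points, so `⋈⇒∼` gives both triangles the same label
  -- on the edge opposite `κ`.
  ≈ᵁ⇒T : ∀ κ p q → (∀ i → i ≢ κ → _⟨_⟩ 𝔅 p i ≈ᵁ _⟨_⟩ 𝔅 q i) → T κ (end p) (end q)
  ≈ᵁ⇒T κ p q p≈q = T-resp-≈ 𝔅 (top≈end p) (top≈end q) (∼⇒T κ (top p) (top q) λ i j i≢κ j≢κ →
    ⋈⇒∼ (trail-valid p) (trail-valid q) (≈ᵁ⇒⋈ (p≈q i i≢κ)) (≈ᵁ⇒⋈ (p≈q j j≢κ)))

  ≈ᵁ⇒≈ : ∀ p q → (∀ i → _⟨_⟩ 𝔅 p i ≈ᵁ _⟨_⟩ 𝔅 q i) → end p ≈ end q
  ≈ᵁ⇒≈ p q p≈q = T-joint (end p) (end q) λ κ → ≈ᵁ⇒T κ p q λ i _ → p≈q i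

-- Involutions of the base and invariance of the generated algebra.

module Shifts {b ℓ : Level} (𝔅 : AtomStructure b ℓ)
              (_≈?_ : Decidable (AtomStructure._≈_ 𝔅))
              (T-sym : ∀ κ s t → AtomStructure.T 𝔅 κ s t → AtomStructure.T 𝔅 κ t s) where
  open AtomStructure 𝔅 using (B; _≈_; T)
    renaming (refl to ≈-refl; sym to ≈-sym; trans to ≈-trans)
  open Trail
  open Setoid (Base 𝔅) using ()
    renaming (_≈_ to _≈ᵁ_; refl to ≈ᵁ-refl; sym to ≈ᵁ-sym; trans to ≈ᵁ-trans)

  infixl 9 _⟪_⟫
  _⟪_⟫ : Trail 𝔅 → Fin 3 → Trail 𝔅
  _⟪_⟫ = _⟨_⟩ 𝔅

  ⇝⇒≈ᵁ : ∀ {p q} → _⇝_ 𝔅 (toList p) (toList q) → p ≈ᵁ q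
  ⇝⇒≈ᵁ p⇝q = fwd p⇝q Star.◅ Star.ε

  ≡⇒≈ᵁ : ∀ {p q} → toList p ≡ toList q → p ≈ᵁ q
  ≡⇒≈ᵁ {p} {q} p≡q = ⇝⇒≈ᵁ (≡.subst (_⇝_ 𝔅 (toList p)) p≡q
    (eq (Pointwise.refl (≈-refl , refl))))

  point : B → Trail 𝔅
  point t = record { prefix = [] ; end = t ; lastIndex = 0F ; linked = [-] }

  headOf : List (Node 𝔅) → B → B
  headOf []            t = t
  headOf ((s , _) ∷ _) t = s

  start : Trail 𝔅 → B
  start p = headOf (prefix p) (end p)

  cons : ∀ s κ (p : Trail 𝔅) → ¬ s ≈ start p → T κ s (start p) → Trail 𝔅
  cons s κ p s≉p sTp = record
    { prefix    = (s , κ) ∷ prefix p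
    ; end       = end p
    ; lastIndex = lastIndex p
    ; linked    = extend (prefix p) s≉p sTp (linked p)
    }
    where
    extend : ∀ xs {t ν} → ¬ s ≈ headOf xs t → T κ s (headOf xs t) →
             Linked (Step 𝔅) (xs ∷ʳ (t , ν)) → Linked (Step 𝔅) ((s , κ) ∷ xs ∷ʳ (t , ν))
    extend []      s≉t sTt lnk = (s≉t , sTt) ∷ lnk
    extend (_ ∷ _) s≉t sTt lnk = (s≉t , sTt) ∷ lnk

  headOf-∷ʳ : ∀ xs {t κ} u → headOf (xs ∷ʳ (t , κ)) u ≡ headOf xs t
  headOf-∷ʳ []      u = refl
  headOf-∷ʳ (_ ∷ _) u = refl

  ⇝-start : ∀ u {xs ys} → _⇝_ 𝔅 xs ys → headOf xs u ≈ headOf ys u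
  ⇝-start u (eq [])                       = ≈-refl
  ⇝-start u (eq ((s≈t , _) ∷ _))          = s≈t
  ⇝-start u (detour [] _ _ _ _ _)         = ≈-refl
  ⇝-start u (detour (_ ∷ _) _ _ _ _ _)    = ≈-refl
  ⇝-start u (truncate [] _ _ _ _ _)       = ≈-refl
  ⇝-start u (truncate (_ ∷ _) _ _ _ _ _)  = ≈-refl
  ⇝-start u (diagonal [] _ _ _ _)         = ≈-refl
  ⇝-start u (diagonal (_ ∷ _) _ _ _ _)    = ≈-refl

  start-cong : ∀ p q → _⇝_ 𝔅 (toList p) (toList q) → start p ≈ start q
  start-cong p q p⇝q = ≡.subst₂ _≈_
    (headOf-∷ʳ (prefix p) (end p)) (headOf-∷ʳ (prefix q) (end p)) (⇝-start (end p) p⇝q)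

  ⇝-∷ : ∀ x {xs ys} → _⇝_ 𝔅 xs ys → _⇝_ 𝔅 (x ∷ xs) (x ∷ ys)
  ⇝-∷ x (eq xs≋ys)                   = eq ((≈-refl , refl) ∷ xs≋ys)
  ⇝-∷ x (detour xs t ν s κ ys)       = detour (x ∷ xs) t ν s κ ys
  ⇝-∷ x (truncate xs t κ s ν κ≢ν)    = truncate (x ∷ xs) t κ s ν κ≢ν
  ⇝-∷ x (diagonal xs t ν κ Eνκ)      = diagonal (x ∷ xs) t ν κ Eνκ

  backtrack : ∀ xs {t ν} κ v →
              _⇝_ 𝔅 ((headOf xs t , κ) ∷ (v , κ) ∷ xs ∷ʳ (t , ν)) (xs ∷ʳ (t , ν))
  backtrack []             κ v = detour [] _ κ v _ []
  backtrack ((_ , _) ∷ xs) κ v = detour [] _ κ v _ (xs ∷ʳ _)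

  cancel : ∀ p {u v κ v≉p vTp u≉v uTv} → u ≈ start p →
           cons u κ (cons v κ p v≉p vTp) u≉v uTv ≈ᵁ p
  cancel p {v = v} {κ} {v≉p} {vTp} {u≉v} {uTv} u≈p = ≈ᵁ-trans
    -- `detour` needs literally the same triangle at both ends, so `u` is first replaced by
    -- `start p`.
    (⇝⇒≈ᵁ {q = cons (start p) κ (cons v κ p v≉p vTp)
                 (λ p≈v → u≉v (≈-trans u≈p p≈v)) (T-resp-≈ 𝔅 u≈p ≈-refl uTv)}
      (eq ((u≈p , refl) ∷ Pointwise.refl (≈-refl , refl))))
    (⇝⇒≈ᵁ (backtrack (prefix p) κ v))

  -- Going back along a step and forth again cancels, so prepending the step
  -- (s , κ) to the trails from t and (t , κ) to those from s is an involution.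
  module Shift {s t : B} {κ : Fin 3} (s≉t : ¬ s ≈ t) (sTt : T κ s t) where

    shift : Trail 𝔅 → Trail 𝔅
    shift p with start p ≈? t | start p ≈? s
    ... | yes p≈t | _       = cons s κ p (λ s≈p → s≉t (≈-trans s≈p p≈t))
                                (T-resp-≈ 𝔅 ≈-refl (≈-sym p≈t) sTt)
    ... | no  _   | yes p≈s = cons t κ p (λ t≈p → s≉t (≈-sym (≈-trans t≈p p≈s)))
                                (T-resp-≈ 𝔅 ≈-refl (≈-sym p≈s) (T-sym κ s t sTt))
    ... | no  _   | no  _   = p

    -- The rules preserve the start up to `≈`, so both trails fall under the same case, and
    -- prepending a step respects every rule.
    shift-⇝ : ∀ p q → _⇝_ 𝔅 (toList p) (toList q) → _⇝_ 𝔅 (toList (shift p)) (toList (shift q))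
    shift-⇝ p q p⇝q
      with start-cong p q p⇝q | start p ≈? t | start p ≈? s | start q ≈? t | start q ≈? s
    ... | p≈q | yes p≈t | _       | yes q≈t | _       = ⇝-∷ _ p⇝q
    ... | p≈q | yes p≈t | _       | no  q≉t | _       =
      contradiction (≈-trans (≈-sym p≈q) p≈t) q≉t
    ... | p≈q | no  p≉t | _       | yes q≈t | _       =
      contradiction (≈-trans p≈q q≈t) p≉t
    ... | p≈q | no  _   | yes _   | no  _   | yes _   = ⇝-∷ _ p⇝q
    ... | p≈q | no  _   | yes p≈s | no  _   | no  q≉s =
      contradiction (≈-trans (≈-sym p≈q) p≈s) q≉s
    ... | p≈q | no  _   | no  p≉s | no  _   | yes q≈s =
      contradiction (≈-trans p≈q q≈s) p≉s
    ... | p≈q | no  _   | no  _   | no  _   | no  _   = p⇝q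

    shift-cong : ∀ {p q} → p ≈ᵁ q → shift p ≈ᵁ shift q
    shift-cong = EqClosure.gmap shift λ {p} {q} → shift-⇝ p q

    shift-⟪⟫ : ∀ p ν → shift (p ⟪ ν ⟫) ≈ᵁ shift p ⟪ ν ⟫
    shift-⟪⟫ p ν with start p ≈? t | start p ≈? s
    ... | yes _ | _     = ≡⇒≈ᵁ refl
    ... | no  _ | yes _ = ≡⇒≈ᵁ refl
    ... | no  _ | no  _ = ≡⇒≈ᵁ refl

    shift-end : ∀ p → end (shift p) ≡ end p
    shift-end p with start p ≈? t | start p ≈? s
    ... | yes _ | _     = refl
    ... | no  _ | yes _ = refl
    ... | no  _ | no  _ = refl

    shift-from : ∀ p → start p ≈ t → ∀ q → toList q ≡ (s , κ) ∷ toList p → shift p ≈ᵁ q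
    shift-from p p≈t q q≡ with start p ≈? t | start p ≈? s
    ... | yes _   | _ = ≡⇒≈ᵁ (≡.sym q≡)
    ... | no  p≉t | _ = contradiction p≈t p≉t

    shift-involutive : ∀ p → shift (shift p) ≈ᵁ p
    shift-involutive p with start p ≈? t | start p ≈? s
    shift-involutive p | yes p≈t | _ with s ≈? t | s ≈? s
    ... | yes s≈t | _       = contradiction s≈t s≉t
    ... | no  _   | no  s≉s = contradiction ≈-refl s≉s
    ... | no  _   | yes _   = cancel p (≈-sym p≈t)
    shift-involutive p | no _ | yes p≈s with t ≈? t
    ... | no  t≉t = contradiction ≈-refl t≉t
    ... | yes _   = cancel p (≈-sym p≈s)
    shift-involutive p | no p≉t | no p≉s with start p ≈? t | start p ≈? s
    ... | yes p≈t | _       = contradiction p≈t p≉t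
    ... | no  _   | yes p≈s = contradiction p≈s p≉s
    ... | no  _   | no  _   = ≈ᵁ-refl

    shift-R : ∀ u v → v ∈ R[_] 𝔅 u → shift ∘ v ∈ R[_] 𝔅 u
    shift-R u v (p , p≈u , v≈p) =
        shift p
      , ≡.subst (_≈ u) (≡.sym (shift-end p)) p≈u
      , λ κ → ≈ᵁ-trans (shift-cong (v≈p κ)) (shift-⟪⟫ p κ)

    -- Induction on the generation of `X`. The complement needs the reverse implication, which
    -- involutivity supplies.
    shift-invariant : ∀ {X} → ℭ 𝔅 X → ∀ v → v ∈ X → shift ∘ v ∈ X
    shift-invariant (generator u) v v∈R = shift-R u v v∈R
    shift-invariant (∪-closed gX gY) v (inj₁ v∈X) = inj₁ (shift-invariant gX v v∈X)
    shift-invariant (∪-closed gX gY) v (inj₂ v∈Y) = inj₂ (shift-invariant gY v v∈Y)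
    shift-invariant (∁-closed {X} gX) v v∉X σv∈X = v∉X
      (resp X (λ κ → shift-involutive (v κ)) (shift-invariant gX (shift ∘ v) σv∈X))
    shift-invariant (C-closed κ gX) v (w , w∈X , w≈v) =
      shift ∘ w , shift-invariant gX w w∈X , λ ν ν≢κ → shift-cong (w≈v ν ν≢κ)
    shift-invariant (D-closed κ ν) v vκ≈vν = shift-cong vκ≈vν
    shift-invariant (⋃-closed F gF (X⊆⋃ , ⋃⊆X)) v v∈X
      with i , v∈Fi ← X⊆⋃ v∈X = ⋃⊆X (i , shift-invariant (gF i) v v∈Fi)

  uncons : ∀ xs {s κ t ν} → Linked (Step 𝔅) ((s , κ) ∷ xs ∷ʳ (t , ν)) →
           (¬ s ≈ headOf xs t × T κ s (headOf xs t)) × Linked (Step 𝔅) (xs ∷ʳ (t , ν))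
  uncons []      (step ∷ lnk) = step , lnk
  uncons (_ ∷ _) (step ∷ lnk) = step , lnk

  module _ {X} (gX : ℭ 𝔅 X) where

    -- Each first step is removed by the involution belonging to that step, under which `X` is
    -- invariant.
    ∈-shrink : ∀ xs {t i} (lnk : Linked (Step 𝔅) (xs ∷ʳ (t , i))) →
      let p = record { prefix = xs ; end = t ; lastIndex = i ; linked = lnk } in
      ((p ⟪_⟫) ∈ X) ⇔ ((point t ⟪_⟫) ∈ X)
    ∈-shrink [] lnk = mk⇔ (resp X λ κ → ≡⇒≈ᵁ refl) (resp X λ κ → ≡⇒≈ᵁ refl)
    ∈-shrink ((s , κ) ∷ xs) {t} {i} lnk with (s≉ , sT) , lnk′ ← uncons xs lnk =
      ∈-shrink xs lnk′ ⇔-∘ mk⇔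
        (λ p∈X → resp X
          (λ ν → ≈ᵁ-trans (shift-cong (≈ᵁ-sym (shift-q ν))) (shift-involutive (q ⟪ ν ⟫)))
          (shift-invariant gX _ p∈X))
        (λ q∈X → resp X shift-q (shift-invariant gX _ q∈X))
      where
      open Shift s≉ sT
      p q : Trail 𝔅
      p = record { prefix = (s , κ) ∷ xs ; end = t ; lastIndex = i ; linked = lnk }
      q = record { prefix = xs ; end = t ; lastIndex = i ; linked = lnk′ }
      shift-q : ∀ ν → shift (q ⟪ ν ⟫) ≈ᵁ p ⟪ ν ⟫
      shift-q ν = shift-from (q ⟪ ν ⟫) ≈-refl (p ⟪ ν ⟫) refl

    -- Consequently a member of `ℭ` contains or misses `R[ t ]` as a whole.
    R-∈ : ∀ {t v} → v ∈ R[_] 𝔅 t → (v ∈ X) ⇔ ((point t ⟪_⟫) ∈ X)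
    R-∈ {t} (p , p≈t , v≈p) = mk⇔
      (λ v∈X → resp X point≈ (to shrink (resp X v≈p v∈X)))
      (λ t∈X → resp X (λ κ → ≈ᵁ-sym (v≈p κ))
                 (from shrink (resp X (λ κ → ≈ᵁ-sym (point≈ κ)) t∈X)))
      where
      open Equivalence
      shrink = ∈-shrink (prefix p) (linked p)
      point≈ : ∀ κ → point (end p) ⟪ κ ⟫ ≈ᵁ point t ⟪ κ ⟫
      point≈ κ = ⇝⇒≈ᵁ (eq ((p≈t , refl) ∷ []))

-- The isomorphism for an atom structure with a labelling.

module Isomorphism {b ℓ r : Level} {𝔅 : AtomStructure b ℓ} (L : Labelling 𝔅 r)
                   (em : ExcludedMiddle (b ⊔ ℓ)) where
  open AtomStructure 𝔅 using (B; _≈_; T; E-resp; setoid)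
    renaming (refl to ≈-refl; sym to ≈-sym; trans to ≈-trans)
  open Labelling L using (T-sym)

  _≈?_ : Decidable _≈_
  s ≈? t = map′ lower lift (em {P = Lift b (s ≈ t)})

  open Walks L _≈?_ using (≈ᵁ⇒E; ≈ᵁ⇒T; ≈ᵁ⇒≈)
  open Shifts 𝔅 _≈?_ T-sym using (_⟪_⟫; point; ⇝⇒≈ᵁ; R-∈)
  open Trail
  open RcSet
  open Setoid (Base 𝔅) using ()
    renaming (_≈_ to _≈ᵁ_; refl to ≈ᵁ-refl; sym to ≈ᵁ-sym; trans to ≈ᵁ-trans)

  R-disjoint : ∀ {v s t} → v ∈ R[_] 𝔅 s → v ∈ R[_] 𝔅 t → s ≈ t
  R-disjoint (p , p≈s , v≈p) (q , q≈t , v≈q) = ≈-trans (≈-sym p≈s)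
    (≈-trans (≈ᵁ⇒≈ p q λ κ → ≈ᵁ-trans (≈ᵁ-sym (v≈p κ)) (v≈q κ)) q≈t)

  point∈R : ∀ t → (point t ⟪_⟫) ∈ R[_] 𝔅 t
  point∈R t = point t , ≈-refl , λ κ → ≈ᵁ-refl

  linked-∷ʳ : ∀ xs {s κ t ν} → Linked (Step 𝔅) (xs ∷ʳ (s , κ)) → ¬ s ≈ t → T κ s t →
              Linked (Step 𝔅) ((xs ∷ʳ (s , κ)) ∷ʳ (t , ν))
  linked-∷ʳ []           [-]          s≉t sTt = (s≉t , sTt) ∷ [-]
  linked-∷ʳ (_ ∷ [])     (step ∷ lnk) s≉t sTt = step ∷ linked-∷ʳ [] lnk s≉t sTt
  linked-∷ʳ (_ ∷ x ∷ xs) (step ∷ lnk) s≉t sTt = step ∷ linked-∷ʳ (x ∷ xs) lnk s≉t sTt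

  -- Steps must change the triangle, so `v` itself serves when the trail already ends at `t`.
  -- Otherwise one more step is appended, and `truncate` moves only the vertex `κ`.
  R-cyl : ∀ κ {s t v} → T κ s t → v ∈ R[_] 𝔅 s →
          ∃[ w ] w ∈ R[_] 𝔅 t × (∀ ν → ν ≢ κ → w ν ≈ᵁ v ν)
  R-cyl κ {s} {t} {v} sTt (p , p≈s , v≈p) with end p ≈? t
  ... | yes p≈t = v , (p , p≈t , v≈p) , λ ν _ → ≈ᵁ-refl
  ... | no  p≉t = (q ⟪_⟫) , (q , ≈-refl , λ ν → ≈ᵁ-refl) , λ ν ν≢κ → ≈ᵁ-trans
    (⇝⇒≈ᵁ (≡.subst (λ xs → _⇝_ 𝔅 xs (toList (p ⟪ ν ⟫)))
      (≡.sym (++-assoc (prefix p) _ _)) (truncate (prefix p) (end p) κ t ν (≢-sym ν≢κ))))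
    (≈ᵁ-sym (v≈p ν))
    where
    q : Trail 𝔅
    q = record
      { prefix    = prefix p ∷ʳ (end p , κ)
      ; end       = t
      ; lastIndex = κ
      ; linked    = linked-∷ʳ (prefix p) (linked (p ⟪ κ ⟫)) p≉t
                      (T-resp-≈ 𝔅 (≈-sym p≈s) ≈-refl sTt)
      }

  R-cong : ∀ {X Y} → X ≗ Y → R⋃ 𝔅 X ≗ R⋃ 𝔅 Y
  R-cong (X⊆Y , Y⊆X) =
      (λ { (t , t∈X , v∈R) → t , X⊆Y t∈X , v∈R })
    , (λ { (t , t∈Y , v∈R) → t , Y⊆X t∈Y , v∈R })

  -- The one-point trail shows that `R[ t ]` is nonempty, and disjointness does the rest.
  R-reflects-⊆ : ∀ {X Y : 𝒫 setoid} → pred (R⋃ 𝔅 X) ⊆ pred (R⋃ 𝔅 Y) → pred X ⊆ pred Y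
  R-reflects-⊆ {Y = Y} RX⊆RY {t} t∈X
    with s , s∈Y , v∈R ← RX⊆RY (t , t∈X , point∈R t) =
    resp Y (R-disjoint v∈R (point∈R t)) s∈Y

  -- By `R-∈` these are the `t` with `R[ t ]` contained in `set Y`.
  R⁻¹ : RcSet 𝔅 → 𝒫 setoid
  R⁻¹ Y = subset (λ t → (point t ⟪_⟫) ∈ set Y)
    λ s≈t → resp (set Y) λ κ → ⇝⇒≈ᵁ (eq ((s≈t , refl) ∷ []))

  R-isIsomorphism : IsIsomorphism (Cm 𝔅) (Rc 𝔅 em) (R 𝔅)
  R-isIsomorphism = record
    { cong       = λ {X} {Y} → R-cong {X} {Y}
    ; ∨-homo     = λ X Y →
        (λ { (t , inj₁ t∈X , v∈R) → inj₁ (t , t∈X , v∈R)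
           ; (t , inj₂ t∈Y , v∈R) → inj₂ (t , t∈Y , v∈R) })
      , (λ { (inj₁ (t , t∈X , v∈R)) → t , inj₁ t∈X , v∈R
           ; (inj₂ (t , t∈Y , v∈R)) → t , inj₂ t∈Y , v∈R })
    ; ∧-homo     = λ X Y →
        (λ { (t , (t∈X , t∈Y) , v∈R) → (t , t∈X , v∈R) , (t , t∈Y , v∈R) })
      , (λ { ((s , s∈X , v∈Rs) , (t , t∈Y , v∈Rt)) →
               t , (resp X (R-disjoint v∈Rs v∈Rt) s∈X , t∈Y) , v∈Rt })
    ; compl-homo = λ X →
        (λ { (t , t∉X , v∈Rt) → (t , v∈Rt) ,
             λ { (s , s∈X , v∈Rs) → t∉X (resp X (R-disjoint v∈Rs v∈Rt) s∈X) } })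
      , (λ { ((t , v∈Rt) , v∉RX) → t , (λ t∈X → v∉RX (t , t∈X , v∈Rt)) , v∈Rt })
    ; zero-homo  = (λ { (_ , () , _) }) , λ ()
    ; one-homo   = (λ { (t , _ , v∈R) → t , v∈R }) , (λ { (t , v∈R) → t , tt , v∈R })
    ; cyl-homo   = λ κ X →
        (λ { (s , (t , t∈X , sTt) , v∈Rs) →
             let w , w∈Rt , w≈v = R-cyl κ sTt v∈Rs in
             (s , v∈Rs) , w , (t , t∈X , w∈Rt) , w≈v })
      -- Agreement of `v` and `w` off `κ` passes to the trails `p` and `q`, whose ends are then
      -- related by `≈ᵁ⇒T`.
      , (λ { ((s , v∈Rs@(p , p≈s , v≈p)) , w , (t , t∈X , (q , q≈t , w≈q)) , w≈v) →
             s , (t , t∈X , T-resp-≈ 𝔅 p≈s q≈t (≈ᵁ⇒T κ p q λ ν ν≢κ →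
               ≈ᵁ-trans (≈ᵁ-sym (v≈p ν)) (≈ᵁ-trans (≈ᵁ-sym (w≈v ν ν≢κ)) (w≈q ν)))) , v∈Rs })
    ; diag-homo  = λ κ ν →
        (λ { (t , lift Et , v∈R@(p , p≈t , v≈p)) → (t , v∈R) ,
             ≈ᵁ-trans (v≈p κ) (≈ᵁ-trans
               (⇝⇒≈ᵁ (diagonal (prefix p) (end p) κ ν (E-resp κ ν (≈-sym p≈t) Et)))
               (≈ᵁ-sym (v≈p ν))) })
      , (λ { ((t , v∈R@(p , p≈t , v≈p)) , vκ≈vν) →
             t , lift (E-resp κ ν p≈t (≈ᵁ⇒E p
               (≈ᵁ-trans (≈ᵁ-sym (v≈p κ)) (≈ᵁ-trans vκ≈vν (v≈p ν))))) , v∈R })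
    ; injective  = λ { {X} {Y} (RX⊆RY , RY⊆RX) →
        R-reflects-⊆ {X} {Y} RX⊆RY , R-reflects-⊆ {Y} {X} RY⊆RX }
    ; surjective = λ Y → R⁻¹ Y , λ { {Z} (Z⊆ , ⊆Z) →
        (λ { (t , t∈Z , v∈R) → Equivalence.from (R-∈ (in-ℭ Y) v∈R) (Z⊆ t∈Z) })
      , (λ v∈Y → let t , v∈R = ⊆V Y v∈Y in
           t , ⊆Z (Equivalence.to (R-∈ (in-ℭ Y) v∈R) v∈Y) , v∈R) }
    }

-- The suitable structure of a weakly associative relation algebra.

suitableLabelling : ∀ {a ℓ} → ExcludedMiddle ℓ → (𝔄 : WA a ℓ) →
                    Labelling (suitableStructure 𝔄) (a ⊔ ℓ)
suitableLabelling em 𝔄 = record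
  { T-sym           = λ κ s t → ≈-sym
  ; T-joint         = λ s t sTt → sTt
  ; E-refl          = λ s i → same
  ; E-sym           = E-sym
  ; E-trans         = E-trans
  ; E-T             = E-T
  ; _∼_             = _∼_
  ; ∼-isEquivalence = ∼-isEquivalence
  ; ∼-flip          = ∼-flip
  ; ∼-≈             = ∼-≈
  ; ∼-E             = ∼-E
  ; ∼-T             = ∼-T
  ; ∼⇒T             = ∼⇒T
  }
  where
  open WA 𝔄
  open EdgeLabels em 𝔄

theorem4 : {a ℓ : Level} (em : ExcludedMiddle (a ⊔ ℓ)) (𝔄 : WA a ℓ) → WA.Atomic 𝔄 →
    IsIsomorphism (Cm (suitableStructure 𝔄)) (Rc (suitableStructure 𝔄) em) (R (suitableStructure 𝔄))
theorem4 {a} em 𝔄 _ = Isomorphism.R-isIsomorphism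
  (suitableLabelling (map′ lower lift (em {P = Lift a _})) 𝔄) em
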